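{- Let $R\geq 4$, let $q'\geq 3$ be a prime power and let $q=(q')^{R}$. Put $$n^{(1)}_{R,q}=(\sqrt[R]{q}-1)\left(\frac{R(R+1)}{2}-2\right)+R+5,$$ and let $t_0$ be an integer with $q^{t_0-1}\geq n^{(1)}_{R,q}$. Then for every codimension $r=Rt+1$ with $t=1$ or $t\geq t_0$ there exists a linear $[n,n-r]_q$ code with covering radius $R$ and length $$n=n^{(1)}_{R,q}\cdot q^{\frac{r-(R+1)}{R}}+\begin{cases}0 & \text{if } q'\geq 4,\\[2pt] w\,\dfrac{q^{\frac{r-(R+1)}{R}}-1}{q-1}\ \text{ for some } w\in\{0,1\} & \text{if } q'=3.\end{cases}$$
   Context: For a prime power $q$, an $[n,n-r]_q$ code is a linear subspace of $F_q^n$ of dimension $n-r$ (codimension $r$). It has covering radius $R$ if every column of $F_q^{r}$ is a linear combination of at most $R$ columns of a parity-check matrix of the code, and $R$ is the smallest integer with this property (equivalently, the spheres of radius $R$ around codewords cover $F_q^n$). -}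

module Defs where

open import Level using (Level)
open import Algebra.Bundles using (CommutativeRing)
open import Data.Nat as ℕ using (ℕ; zero; suc; _≤_)
open import Data.Nat.Primality using (Prime)
open import Data.Fin as Fin using (Fin)
open import Data.Product using (Σ; ∃; _×_)
open import Relation.Nullary using (¬_)
open import Relation.Binary.PropositionalEquality as ≡ using (_≡_)
open import Function.Bundles using (Bijection)

IsPrimePower : ℕ → Set
IsPrimePower q = Σ ℕ λ p → Σ ℕ λ k → Prime p × 1 ≤ k × q ≡ p ℕ.^ k

record IsField {c ℓ : Level} (K : CommutativeRing c ℓ) : Set (c Level.⊔ ℓ) where
  open CommutativeRing K
  field
    0≉1     : ¬ (0# ≈ 1#)
    inverse : ∀ x → ¬ (x ≈ 0#) → Σ Carrier λ y → (x * y) ≈ 1#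

HasOrder : {c ℓ : Level} → CommutativeRing c ℓ → ℕ → Set (c Level.⊔ ℓ)
HasOrder K q = Bijection (≡.setoid (Fin q)) (CommutativeRing.setoid K)

module _ {c ℓ : Level} (K : CommutativeRing c ℓ) where
  open CommutativeRing K

  Σ[_] : (k : ℕ) → (Fin k → Carrier) → Carrier
  Σ[ zero  ] f = 0#
  Σ[ suc k ] f = f Fin.zero + Σ[ k ] (λ i → f (Fin.suc i))

  -- A parity-check matrix of an [n, n-r] code: r rows, n columns
  Matrix : ℕ → ℕ → Set c
  Matrix r n = Fin r → Fin n → Carrier

  CombOfAtMost : {r n : ℕ} → Matrix r n → ℕ → (Fin r → Carrier) → Set (c Level.⊔ ℓ)
  CombOfAtMost {r} {n} H m s =
    Σ ℕ λ k → k ≤ m × Σ (Fin k → Fin n) λ j → Σ (Fin k → Carrier) λ a →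
      ∀ (row : Fin r) → s row ≈ Σ[ k ] (λ i → a i * H row (j i))

  Covers : {r n : ℕ} → Matrix r n → ℕ → Set (c Level.⊔ ℓ)
  Covers {r} H m = ∀ (s : Fin r → Carrier) → CombOfAtMost H m s

  HasCoveringRadius : {r n : ℕ} → Matrix r n → ℕ → Set (c Level.⊔ ℓ)
  HasCoveringRadius H R = Covers H R × (∀ R' → Covers H R' → R ≤ R')

n1 : ℕ → ℕ → ℕ
n1 R q' = (q' ℕ.∸ 1) ℕ.* ((R ℕ.* (R ℕ.+ 1)) ℕ./ 2 ℕ.∸ 2) ℕ.+ R ℕ.+ 5

-- division with the convention m /' 0 = 0 (only used with nonzero divisor)
_/'_ : ℕ → ℕ → ℕ
m /' zero  = 0
m /' suc d = m ℕ./ suc d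

{-# OPTIONS --safe #-}

-- Let F be the subfield of K of order q', so that [K : F] = R. Any s in K^(R+1) satisfies a
-- nontrivial linear relation c · s = 0 over F (pigeonhole, since q'^(R+1) > q), so s is a
-- K-combination of R points of a point set in PG(R, q') whenever that set spans the hyperplane c.
-- Such a set consists of all points on the edges of the coordinate simplex, except that the six
-- edges on four of the vertices are replaced by four pairwise skew lines of PG(3, q') without a
-- common transversal; it has n1 points. Since the edges through a vertex carry q' + 1 ≥ 4 points,
-- the combination can be chosen with exactly R distinct points and nonzero coefficients.
--
-- This exactness makes the q^m-concatenating construction applicable without extra columns, so
-- that w = 0 always works. As n1 ≤ q, its multipliers β_j can be taken distinct in K itself: the
-- columns are (h_j, ξ, β_j ξ, …, β_j^(R-1) ξ) with ξ in K^(t-1), and R of them with prescribed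
-- distinct j are solved for the ξ by a Vandermonde system.
--
-- For the lower bound, a combination of fewer than R points of F^(R+1) has coordinates satisfying
-- a nontrivial relation over F inside any R chosen rows, unlike a syndrome with R independent
-- coordinates over F.

module Submission where

open import Defs
open import Level using (Level; _⊔_)
open import Algebra.Bundles using (CommutativeMonoid; CommutativeRing)
open import Data.Empty using (⊥-elim)
open import Data.Fin as Fin using (Fin; zero; suc; toℕ; fromℕ; fromℕ<; inject₁; splitAt; _↑ˡ_; _↑ʳ_; combine; remQuot; finToFun; funToFin)
open import Data.Fin.Patterns using (0F; 1F; 2F; 3F)
import Data.Fin.Permutation as Perm
import Data.Fin.Properties as Finₚ
open import Data.List using (List; []; _∷_; _++_; map; length; filter; lookup; allFin; take; tabulate)
open import Data.List.Membership.Propositional using (_∈_)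
open import Data.List.Membership.Propositional.Properties using (∈-filter⁺; ∈-allFin; ∈-lookup)
import Data.List.Properties as Listₚ
open import Data.List.Relation.Binary.Permutation.Propositional as ↭ using (_↭_; ↭-refl; prep; ↭-trans; ↭-sym)
import Data.List.Relation.Binary.Permutation.Propositional.Properties as ↭ₚ
open import Data.List.Relation.Unary.All as All using (All; []; _∷_)
import Data.List.Relation.Unary.All.Properties as Allₚ
open import Data.List.Relation.Unary.AllPairs as AllPairs using (AllPairs; []; _∷_)
import Data.List.Relation.Unary.AllPairs.Properties as AllPairsₚ
open import Data.List.Relation.Unary.Any as Any using (here; there)
open import Data.List.Relation.Unary.Any.Properties using (lookup-index)
open import Data.List.Relation.Unary.Unique.Propositional using (Unique)
open import Data.List.Relation.Unary.Unique.Propositional.Properties using (allFin⁺; filter⁺; take⁺)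
open import Data.Maybe using (Maybe; just; nothing)
open import Data.Nat as ℕ using (ℕ; zero; suc; _≤_; _<_; z≤n; s≤s; _!; _∸_)
open import Data.Nat.Combinatorics using (_C_; nCn≡1; nCk≡nC[n∸k]; nCk≡n!/k![n-k]!; k![n∸k]!∣n!)
open import Data.Nat.Divisibility using (_∣_; divides; ∣⇒≤; m∣m*n)
open import Data.Nat.DivMod using (m/n*n≡m; m*n/n≡m)
open import Data.Nat.Primality using (Prime; euclidsLemma; prime⇒nonTrivial)
import Data.Nat.Properties as ℕₚ
open import Data.Nat.Solver using (module +-*-Solver)
open import Data.Product using (Σ; ∃; ∃₂; _×_; _,_; proj₁; proj₂; map₁; uncurry)
open import Data.Sum using (_⊎_; inj₁; inj₂; [_,_]′) renaming (map to map-⊎)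
import Data.Sum.Properties as Sumₚ
open import Function using (_∘_; id)
open import Function.Bundles using (Bijection)
open import Relation.Binary.Definitions using (Decidable; WeaklyDecidable)
open import Relation.Binary.PropositionalEquality as ≡ using (_≡_; _≢_)
open import Relation.Nullary using (¬_; Dec; yes; no; ¬?)
open import Relation.Nullary.Decidable using (map′; decidable-stable)
open import Relation.Unary using (Pred) renaming (Decidable to Decidable₁)

-- Why the core works: a plane of PG(3, q') that contains none of the four lines meets them in four
-- points, and if these were collinear, their line would be a common transversal; a plane that
-- contains one of the lines meets the others off it. Either way three of the points span the plane.
-- Origin of the length: the edges of a simplex on R + 1 vertices carry R + 1 vertices and (q' - 1)
-- R(R + 1)/2 further points; replacing the 6(q' - 1) + 4 points of a tetrahedron by the 4(q' + 1)
-- points of the core saves 2(q' - 1) and costs 4. An obstacle is that K is given only as some field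
-- with q elements. F has to be found inside it, as the solutions of x^q' = x: Frobenius makes them
-- additively closed, and a count of roots gives their number. The delicate demand is exactness,
-- since fewer than R columns would leave too few unknowns ξ for R equations. Missing terms are
-- created in pairs: two points on an edge through e₀ differ by a multiple of e₀.

module IntegerSolver {c ℓ : Level} (K : CommutativeRing c ℓ) where

  open CommutativeRing K hiding (zero)
  open import Algebra.Properties.Ring ring
    using (-‿distribˡ-*; -‿distribʳ-*; -0#≈0#; -‿involutive; -‿+-comm)
  open import Algebra.Properties.Semiring.Mult.TCOptimised semiring
    using (×-homo-+; ×1-homo-*; 1+×) renaming (_×_ to _·_)
  open import Algebra.Solver.Ring.AlmostCommutativeRing
    using (AlmostCommutativeRing; fromCommutativeRing; _-Raw-AlmostCommutative⟶_; Induced-equivalence)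
  open import Relation.Binary.Reasoning.Setoid setoid
  open import Data.Integer as ℤ using (ℤ; +_; -[1+_]; _⊖_)
  import Data.Integer.Properties as ℤₚ

  -- Integer coefficients can be compared by computation, so the ring solver cancels terms such as x
  -- - x without deciding equality in K.
  fromℤ : ℤ → Carrier
  fromℤ (+ n)    = n · 1#
  fromℤ -[1+ n ] = - (suc n · 1#)

  fromℤ-neg : ∀ i → fromℤ (ℤ.- i) ≈ - fromℤ i
  fromℤ-neg (+ zero)  = sym -0#≈0#
  fromℤ-neg (+ suc n) = refl
  fromℤ-neg -[1+ n ]  = sym (-‿involutive _)

  fromℤ-⊖ : ∀ m n → fromℤ (m ⊖ n) ≈ m · 1# - n · 1#
  fromℤ-⊖ m zero = sym (trans (+-congˡ -0#≈0#) (+-identityʳ _))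
  fromℤ-⊖ zero (suc n) = sym (+-identityˡ _)
  fromℤ-⊖ (suc m) (suc n) = begin
    fromℤ (suc m ⊖ suc n)           ≡⟨ ≡.cong fromℤ (ℤₚ.[1+m]⊖[1+n]≡m⊖n m n) ⟩
    fromℤ (m ⊖ n)                   ≈⟨ fromℤ-⊖ m n ⟩
    m · 1# - n · 1#                 ≈⟨ +-congʳ (+-identityˡ _) ⟨
    0# + m · 1# - n · 1#            ≈⟨ +-congʳ (+-congʳ (-‿inverseʳ 1#)) ⟨
    1# - 1# + m · 1# - n · 1#       ≈⟨ +-congʳ (trans (+-assoc _ _ _) (+-congˡ (+-comm _ _))) ⟩
    1# + (m · 1# - 1#) - n · 1#     ≈⟨ +-congʳ (+-assoc _ _ _) ⟨
    1# + m · 1# - 1# - n · 1#       ≈⟨ +-assoc _ _ _ ⟩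
    1# + m · 1# + (- 1# - n · 1#)   ≈⟨ +-cong (sym (1+× m 1#)) (-‿+-comm _ _) ⟩
    suc m · 1# - (1# + n · 1#)      ≈⟨ +-congˡ (-‿cong (1+× n 1#)) ⟨
    suc m · 1# - suc n · 1#         ∎

  fromℤ-+ : ∀ i j → fromℤ (i ℤ.+ j) ≈ fromℤ i + fromℤ j
  fromℤ-+ (+ m)    (+ n)    = ×-homo-+ 1# m n
  fromℤ-+ (+ m)    -[1+ n ] = fromℤ-⊖ m (suc n)
  fromℤ-+ -[1+ m ] (+ n)    = trans (fromℤ-⊖ n (suc m)) (+-comm _ _)
  fromℤ-+ -[1+ m ] -[1+ n ] = begin
    fromℤ (-[1+ m ] ℤ.+ -[1+ n ])        ≡⟨ ≡.cong fromℤ (ℤₚ.neg-distrib-+ (+ suc m) (+ suc n)) ⟨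
    fromℤ (ℤ.- (+ (suc m ℕ.+ suc n)))    ≈⟨ fromℤ-neg (+ (suc m ℕ.+ suc n)) ⟩
    - ((suc m ℕ.+ suc n) · 1#)           ≈⟨ -‿cong (×-homo-+ 1# (suc m) (suc n)) ⟩
    - (suc m · 1# + suc n · 1#)          ≈⟨ -‿+-comm _ _ ⟨
    - (suc m · 1#) - suc n · 1#          ∎

  fromℤ-+* : ∀ m j → fromℤ (+ m ℤ.* j) ≈ m · 1# * fromℤ j
  fromℤ-+* m (+ n) = begin
    fromℤ (+ m ℤ.* + n) ≡⟨ ≡.cong fromℤ (ℤₚ.pos-* m n) ⟨
    (m ℕ.* n) · 1#      ≈⟨ ×1-homo-* m n ⟩
    m · 1# * (n · 1#)   ∎
  fromℤ-+* m -[1+ n ] = begin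
    fromℤ (+ m ℤ.* -[1+ n ])        ≡⟨ ≡.cong fromℤ (ℤₚ.neg-distribʳ-* (+ m) (+ suc n)) ⟨
    fromℤ (ℤ.- (+ m ℤ.* + suc n))   ≈⟨ fromℤ-neg (+ m ℤ.* + suc n) ⟩
    - fromℤ (+ m ℤ.* + suc n)       ≈⟨ -‿cong (fromℤ-+* m (+ suc n)) ⟩
    - (m · 1# * (suc n · 1#))       ≈⟨ -‿distribʳ-* _ _ ⟩
    m · 1# * - (suc n · 1#)         ∎

  fromℤ-* : ∀ i j → fromℤ (i ℤ.* j) ≈ fromℤ i * fromℤ j
  fromℤ-* (+ m) j = fromℤ-+* m j
  fromℤ-* -[1+ m ] j = begin
    fromℤ (-[1+ m ] ℤ.* j)          ≡⟨ ≡.cong fromℤ (ℤₚ.neg-distribˡ-* (+ suc m) j) ⟨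
    fromℤ (ℤ.- (+ suc m ℤ.* j))     ≈⟨ fromℤ-neg (+ suc m ℤ.* j) ⟩
    - fromℤ (+ suc m ℤ.* j)         ≈⟨ -‿cong (fromℤ-+* (suc m) j) ⟩
    - (suc m · 1# * fromℤ j)        ≈⟨ -‿distribˡ-* _ _ ⟩
    - (suc m · 1#) * fromℤ j        ∎

  ℤ⟶K : ℤ.+-*-rawRing -Raw-AlmostCommutative⟶ fromCommutativeRing K
  ℤ⟶K = record
    { ⟦_⟧    = fromℤ
    ; +-homo = fromℤ-+
    ; *-homo = fromℤ-*
    ; -‿homo = fromℤ-neg
    ; 0-homo = refl
    ; 1-homo = refl
    }

  fromℤ-≟ : WeaklyDecidable (Induced-equivalence ℤ⟶K)
  fromℤ-≟ i j with i ℤ.≟ j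
  ... | yes i≡j = just (reflexive (≡.cong fromℤ i≡j))
  -- Distinct integers may have the same image in positive characteristic, so no verdict is given.
  ... | no  _   = nothing

  open import Algebra.Solver.Ring ℤ.+-*-rawRing (fromCommutativeRing K) ℤ⟶K fromℤ-≟ public
    using (Polynomial; con; solve; _:=_; _:+_; _:*_; _:-_; :-_)

  :0 :1 : ∀ {n} → Polynomial n
  :0 = con (+ 0)
  :1 = con (+ 1)

-- Binomial coefficients at a prime

n∣n! : ∀ {n} → 0 < n → n ∣ n !
n∣n! {suc n} _ = m∣m*n (n !)

prime∤! : ∀ {p} → Prime p → ∀ {k} → k < p → ¬ (p ∣ k !)
prime∤! {p} pr {zero} k<p p∣1 = ℕₚ.<⇒≱ (ℕ.nonTrivial⇒n>1 p {{prime⇒nonTrivial pr}}) (∣⇒≤ p∣1)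
prime∤! pr {suc k} k<p p∣ with euclidsLemma (suc k) (k !) pr p∣
... | inj₁ p∣k  = ℕₚ.<⇒≱ k<p (∣⇒≤ p∣k)
... | inj₂ p∣k! = prime∤! pr (ℕₚ.<-trans (ℕₚ.n<1+n k) k<p) p∣k!

-- `p` divides p! = C(p, k) k! (p - k)!, and both factorials have only factors smaller than `p`.
prime∣C : ∀ {p} → Prime p → ∀ {k} → 0 < k → k < p → p ∣ p C k
prime∣C {p} pr {k} 0<k k<p with euclidsLemma (p C k) (k ! ℕ.* (p ∸ k) !) pr p∣prod
  where
  instance
    k!≢0 : ℕ.NonZero (k ! ℕ.* (p ∸ k) !)
    k!≢0 = k ℕₚ.!* (p ∸ k) !≢0
  eq : (p C k) ℕ.* (k ! ℕ.* (p ∸ k) !) ≡ p !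
  eq = ≡.trans (≡.cong (ℕ._* (k ! ℕ.* (p ∸ k) !)) (nCk≡n!/k![n-k]! (ℕₚ.<⇒≤ k<p)))
         (m/n*n≡m (k![n∸k]!∣n! (ℕₚ.<⇒≤ k<p)))
  p∣prod : p ∣ (p C k) ℕ.* (k ! ℕ.* (p ∸ k) !)
  p∣prod = ≡.subst (p ∣_) (≡.sym eq) (n∣n! (ℕₚ.<-trans 0<k k<p))
... | inj₁ p∣C = p∣C
... | inj₂ p∣k!l! with euclidsLemma (k !) ((p ∸ k) !) pr p∣k!l!
...   | inj₁ p∣k! = ⊥-elim (prime∤! pr k<p p∣k!)
...   | inj₂ p∣l! = ⊥-elim (prime∤! pr (ℕₚ.∸-monoʳ-< 0<k (ℕₚ.<⇒≤ k<p)) p∣l!)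

-- Arithmetic of a finite field

module FieldProperties {c ℓ : Level} (K : CommutativeRing c ℓ) (isField : IsField K)
                       (q : ℕ) (order : HasOrder K q) where

  open CommutativeRing K
  open IsField isField
  open IntegerSolver K
  open import Algebra.Properties.Ring ring using (-0#≈0#)
  open import Algebra.Properties.Semiring.Exp semiring public using (_^_; ^-congˡ; ^-assocʳ)
  open import Algebra.Properties.CommutativeSemiring.Exp commutativeSemiring public using (^-distrib-*)
  open import Algebra.Properties.Semiring.Mult semiring as Mult using ()
  open import Algebra.Properties.Semiring.Sum semiring as Sum public
    using (sum; sum-cong-≋; ∑-distrib-+; ∑-comm; *-distribˡ-sum; *-distribʳ-sum; sum-init-last; sum-replicate-zero)
  open import Algebra.Properties.CommutativeMonoid.Sum *-commutativeMonoid as Prod using ()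
  open import Relation.Binary.Reasoning.Setoid setoid

  element : Fin q → Carrier
  element = Bijection.to order

  index : Carrier → Fin q
  index x = proj₁ (Bijection.surjective order x)

  element-index : ∀ x → element (index x) ≈ x
  element-index x = proj₂ (Bijection.surjective order x) ≡.refl

  element-injective : ∀ {i j} → element i ≈ element j → i ≡ j
  element-injective = Bijection.injective order

  index-injective : ∀ {x y} → index x ≡ index y → x ≈ y
  index-injective {x} {y} eq = trans (sym (element-index x)) (trans (reflexive (≡.cong element eq)) (element-index y))

  index-cong : ∀ {x y} → x ≈ y → index x ≡ index y
  index-cong {x} {y} x≈y = element-injective (trans (element-index x) (trans x≈y (sym (element-index y))))

  index-element : ∀ i → index (element i) ≡ i
  index-element i = element-injective (element-index (element i))

  infix 4 _≟_ _≉0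
  abstract
    _≟_ : Decidable _≈_
    x ≟ y = map′ index-injective index-cong (index x Fin.≟ index y)

  _≉0 : Carrier → Set ℓ
  x ≉0 = ¬ (x ≈ 0#)

  1≉0 : 1# ≉0
  1≉0 1≈0 = 0≉1 (sym 1≈0)

  abstract
    recip : Carrier → Carrier
    recip x with x ≟ 0#
    -- A default value; the lemmas on `recip` assume a nonzero argument.
    ... | yes _  = 0#
    ... | no x≉0 = proj₁ (inverse x x≉0)

    *-recip : ∀ {x} → x ≉0 → x * recip x ≈ 1#
    *-recip {x} x≉0 with x ≟ 0#
    ... | yes x≈0 = ⊥-elim (x≉0 x≈0)
    ... | no  x≉0 = proj₂ (inverse x x≉0)

  *-cancel-≉0 : ∀ {x y} → x ≉0 → x * y ≈ 0# → y ≈ 0#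
  *-cancel-≉0 {x} {y} x≉0 xy≈0 = begin
    y                   ≈⟨ *-identityˡ y ⟨
    1# * y              ≈⟨ *-congʳ (*-recip x≉0) ⟨
    x * recip x * y     ≈⟨ solve 3 (λ x z y → x :* z :* y := z :* (x :* y)) refl x (recip x) y ⟩
    recip x * (x * y)   ≈⟨ *-congˡ xy≈0 ⟩
    recip x * 0#        ≈⟨ zeroʳ _ ⟩
    0#                  ∎

  zero-product : ∀ x y → x * y ≈ 0# → x ≈ 0# ⊎ y ≈ 0#
  zero-product x y xy≈0 with x ≟ 0#
  ... | yes x≈0 = inj₁ x≈0
  ... | no  x≉0 = inj₂ (*-cancel-≉0 x≉0 xy≈0)

  *-≉0 : ∀ {x y} → x ≉0 → y ≉0 → x * y ≉0
  *-≉0 x≉0 y≉0 xy≈0 = y≉0 (*-cancel-≉0 x≉0 xy≈0)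

  recip-≉0 : ∀ {x} → x ≉0 → recip x ≉0
  recip-≉0 {x} x≉0 r≈0 = 1≉0 (trans (sym (*-recip x≉0)) (trans (*-congˡ r≈0) (zeroʳ x)))

  -‿≉0 : ∀ {x} → x ≉0 → - x ≉0
  -‿≉0 {x} x≉0 -x≈0 = x≉0 (begin
    x        ≈⟨ solve 1 (λ x → x := :- (:- x)) refl x ⟩
    - (- x)  ≈⟨ -‿cong -x≈0 ⟩
    - 0#     ≈⟨ -0#≈0# ⟩
    0#       ∎)

  x-y≈0⇒x≈y : ∀ {x y} → x - y ≈ 0# → x ≈ y
  x-y≈0⇒x≈y {x} {y} eq = begin
    x          ≈⟨ solve 2 (λ x y → x := (x :- y) :+ y) refl x y ⟩
    x - y + y  ≈⟨ +-congʳ eq ⟩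
    0# + y     ≈⟨ +-identityˡ y ⟩
    y          ∎

  x≈y⇒x-y≈0 : ∀ {x y} → x ≈ y → x - y ≈ 0#
  x≈y⇒x-y≈0 {x} {y} eq = trans (+-congʳ eq) (-‿inverseʳ y)

  ≉⇒-≉0 : ∀ {x y} → ¬ (x ≈ y) → x - y ≉0
  ≉⇒-≉0 x≉y eq = x≉y (x-y≈0⇒x≈y eq)

  *-recip-cancelˡ : ∀ {x} y → x ≉0 → x * (recip x * y) ≈ y
  *-recip-cancelˡ {x} y x≉0 = trans (sym (*-assoc _ _ _)) (trans (*-congʳ (*-recip x≉0)) (*-identityˡ y))

  *-injectiveˡ : ∀ {x y z} → x ≉0 → x * y ≈ x * z → y ≈ z
  *-injectiveˡ {x} {y} {z} x≉0 eq = x-y≈0⇒x≈y (*-cancel-≉0 x≉0 (begin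
    x * (y - z)    ≈⟨ solve 3 (λ x y z → x :* (y :- z) := x :* y :- x :* z) refl x y z ⟩
    x * y - x * z  ≈⟨ x≈y⇒x-y≈0 eq ⟩
    0#             ∎))

  ^-≈0 : ∀ x n → x ^ n ≈ 0# → x ≈ 0#
  ^-≈0 x zero    1≈0 = ⊥-elim (1≉0 1≈0)
  ^-≈0 x (suc n) eq = [ id , ^-≈0 x n ]′ (zero-product x (x ^ n) eq)

  1^n≈1 : ∀ n → 1# ^ n ≈ 1#
  1^n≈1 zero    = refl
  1^n≈1 (suc n) = trans (*-identityˡ _) (1^n≈1 n)

  permutation : (f g : Carrier → Carrier) → (∀ {x y} → x ≈ y → f x ≈ f y) → (∀ {x y} → x ≈ y → g x ≈ g y) →
                (∀ x → f (g x) ≈ x) → (∀ x → g (f x) ≈ x) → Perm.Permutation q q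
  permutation f g f-cong g-cong fg gf = Perm.permutation (λ i → index (f (element i))) (λ i → index (g (element i)))
    (λ i → ≡.trans (index-cong (trans (f-cong (element-index _)) (fg _))) (index-element i))
    (λ i → ≡.trans (index-cong (trans (g-cong (element-index _)) (gf _))) (index-element i))

  -- Adding 1 permutes the field, so the sum of all elements does not change when q times 1 is added
  -- to it.
  order×1≈0 : q Mult.× 1# ≈ 0#
  order×1≈0 = begin
    q Mult.× 1#                                    ≈⟨ Sum.sum-replicate q ⟨
    sum {q} (λ _ → 1#)                             ≈⟨ solve 2 (λ s t → s := (t :+ s) :- t) refl _ (sum element) ⟩
    sum element + sum {q} (λ _ → 1#) - sum element ≈⟨ +-congʳ (∑-distrib-+ element (λ _ → 1#)) ⟨
    sum (λ i → element i + 1#) - sum element       ≈⟨ +-congʳ (sum-cong-≋ (λ i → sym (element-index (element i + 1#)))) ⟩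
    sum (λ i → element (index (element i + 1#))) - sum element
                                                   ≈⟨ x≈y⇒x-y≈0 (sym (Sum.sum-permute element shift)) ⟩
    0#                                             ∎
    where
    shift : Perm.Permutation q q
    shift = permutation (_+ 1#) (_- 1#) +-congʳ +-congʳ
      (λ x → solve 2 (λ x y → (x :- y) :+ y := x) refl x 1#)
      (λ x → solve 2 (λ x y → (x :+ y) :- y := x) refl x 1#)

-- Sums, splitting of lists, geometric series

module _ {c ℓ : Level} (M : CommutativeMonoid c ℓ) where
  open CommutativeMonoid M
  open import Algebra.Properties.CommutativeMonoid.Sum M

  sum-zero : ∀ {n} (t : Fin n → Carrier) → (∀ i → t i ≈ ε) → sum t ≈ ε
  sum-zero {n} t t≈ε = trans (sum-cong-≋ t≈ε) (sum-replicate-zero n)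

  sum-single : ∀ {n} (t : Fin n → Carrier) i → (∀ j → j ≢ i → t j ≈ ε) → sum t ≈ t i
  sum-single t zero t≈ε = trans (∙-congˡ (sum-zero (t ∘ suc) λ j → t≈ε (suc j) λ ())) (identityʳ _)
  sum-single t (suc i) t≈ε = trans
    (∙-cong (t≈ε zero λ ()) (sum-single (t ∘ suc) i λ j j≢i → t≈ε (suc j) (j≢i ∘ Finₚ.suc-injective)))
    (identityˡ _)

module _ {a p} {A : Set a} {P : Pred A p} (P? : Decidable₁ P) where

  filter-++-∁-↭ : ∀ xs → xs ↭ filter P? xs ++ filter (¬? ∘ P?) xs
  filter-++-∁-↭ [] = ↭-refl
  filter-++-∁-↭ (x ∷ xs) with P? x
  ... | yes _ = prep x (filter-++-∁-↭ xs)
  ... | no  _ = ↭-trans (prep x (filter-++-∁-↭ xs)) (↭-sym (↭ₚ.shift x (filter P? xs) _))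

  length-filter-∁ : ∀ xs → length (filter P? xs) ℕ.+ length (filter (¬? ∘ P?) xs) ≡ length xs
  length-filter-∁ xs = ≡.trans (≡.sym (Listₚ.length-++ (filter P? xs))) (≡.sym (↭ₚ.↭-length (filter-++-∁-↭ xs)))

lookup-injective : ∀ {a b} {A : Set a} {B : Set b} (f : A → B) {xs} → AllPairs (λ x y → f x ≢ f y) xs →
                   ∀ i j → f (lookup xs i) ≡ f (lookup xs j) → i ≡ j
lookup-injective f {_ ∷ _} u        zero    zero    eq = ≡.refl
lookup-injective f {_ ∷ _} (x∉ ∷ _) zero    (suc j) eq = ⊥-elim (All.lookup x∉ (∈-lookup j) eq)
lookup-injective f {_ ∷ _} (x∉ ∷ _) (suc i) zero    eq = ⊥-elim (All.lookup x∉ (∈-lookup i) (≡.sym eq))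
lookup-injective f {_ ∷ _} (_ ∷ u)  (suc i) (suc j) eq = ≡.cong suc (lookup-injective f u i j eq)

-- The series 1 + (r + 1) + ... + (r + 1)^(n - 1), with ratio r + 1. For ratio q' and as many terms
-- as the degree of K over F it equals (q - 1)/(q' - 1), obtained without subtraction or division.
geometric : ℕ → ℕ → ℕ
geometric r zero    = 0
geometric r (suc n) = suc (suc r ℕ.* geometric r n)

suc-*-geometric : ∀ r n → suc (r ℕ.* geometric r n) ≡ suc r ℕ.^ n
suc-*-geometric r zero    = ≡.cong suc (ℕₚ.*-zeroʳ r)
suc-*-geometric r (suc n) = ≡.trans (identity r (geometric r n)) (≡.cong (suc r ℕ.*_) (suc-*-geometric r n))
  where
  open +-*-Solver
  identity : ∀ r g → suc (r ℕ.* suc (suc r ℕ.* g)) ≡ suc r ℕ.* suc (r ℕ.* g)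
  identity = solve 2 (λ r g → con 1 :+ r :* (con 1 :+ (con 1 :+ r) :* g) := (con 1 :+ r) :* (con 1 :+ r :* g)) ≡.refl

-- Polynomial functions and the number of their roots

module Polynomials {c ℓ : Level} (K : CommutativeRing c ℓ) (isField : IsField K)
                   (q : ℕ) (order : HasOrder K q) where

  open CommutativeRing K
  open IntegerSolver K
  open FieldProperties K isField q order
  open import Relation.Binary.Reasoning.Setoid setoid

  -- Horner form of a polynomial with formal degree and leading coefficient as indices. It certifies
  -- a function: only values matter for counting roots, so no ring of polynomials is built.
  data Poly : ℕ → Carrier → (Carrier → Carrier) → Set (c ⊔ ℓ) where
    const  : ∀ {l f} → (∀ x → f x ≈ l) → Poly 0 l f
    horner : ∀ {d l f g} a → Poly d l g → (∀ x → f x ≈ x * g x + a) → Poly (suc d) l f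

  poly-resp : ∀ {d l f g} → (∀ x → f x ≈ g x) → Poly d l f → Poly d l g
  poly-resp f≈g (const eq)      = const (λ x → trans (sym (f≈g x)) (eq x))
  poly-resp f≈g (horner a p eq) = horner a p (λ x → trans (sym (f≈g x)) (eq x))

  -- The degree is positive because in degree 0 the added constant would alter the leading
  -- coefficient.
  poly-+-const : ∀ {d l f} b → Poly (suc d) l f → Poly (suc d) l (λ x → f x + b)
  poly-+-const b (horner a p eq) = horner (a + b) p (λ x → trans (+-congʳ (eq x)) (+-assoc _ _ _))

  poly-shift : ∀ n {d l f} → Poly d l f → Poly (n ℕ.+ d) l (λ x → x ^ n * f x)
  poly-shift zero    p = poly-resp (λ x → sym (*-identityˡ _)) p
  poly-shift (suc n) p = horner 0# (poly-shift n p) (λ x → trans (*-assoc _ _ _) (sym (+-identityʳ _)))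

  poly-degree : ∀ {d d′ l f} → d ≡ d′ → Poly d l f → Poly d′ l f
  poly-degree ≡.refl p = p

  poly-^ : ∀ n → Poly n 1# (_^ n)
  poly-^ zero    = const (λ _ → refl)
  poly-^ (suc n) = horner 0# (poly-^ n) (λ x → sym (+-identityʳ _))

  -- Synthetic division. The quotient inherits the leading coefficient, which lets `roots-bound`
  -- recurse on it.
  poly-divide : ∀ {d l f} → Poly (suc d) l f → ∀ a →
                Σ (Carrier → Carrier) λ g → Poly d l g × (∀ x → f x ≈ (x - a) * g x + f a)
  poly-divide {l = l} {f} (horner {g = g} b (const g≈l) eq) a =
    (λ _ → l) , const (λ _ → refl) , λ x → begin
      f x                           ≈⟨ eq x ⟩
      x * g x + b                   ≈⟨ +-congʳ (*-congˡ (g≈l x)) ⟩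
      x * l + b                     ≈⟨ solve 4 (λ x l a b → x :* l :+ b := (x :- a) :* l :+ (a :* l :+ b)) refl x l a b ⟩
      (x - a) * l + (a * l + b)     ≈⟨ +-congˡ (+-congʳ (*-congˡ (g≈l a))) ⟨
      (x - a) * l + (a * g a + b)   ≈⟨ +-congˡ (eq a) ⟨
      (x - a) * l + f a             ∎
  poly-divide {l = l} {f} (horner {g = g} b p@(horner _ _ _) eq) a with poly-divide p a
  ... | h , ph , g≈ = (λ x → x * h x + g a) , horner (g a) ph (λ _ → refl) , λ x → begin
      f x                                       ≈⟨ eq x ⟩
      x * g x + b                               ≈⟨ +-congʳ (*-congˡ (g≈ x)) ⟩
      x * ((x - a) * h x + g a) + b             ≈⟨ solve 5 (λ x a h g b → x :* ((x :- a) :* h :+ g) :+ b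
                                                    := (x :- a) :* (x :* h :+ g) :+ (a :* g :+ b)) refl x a (h x) (g a) b ⟩
      (x - a) * (x * h x + g a) + (a * g a + b) ≈⟨ +-congˡ (eq a) ⟨
      (x - a) * (x * h x + g a) + f a           ∎

  roots-bound : ∀ {d l f} → Poly d l f → l ≉0 → ∀ is → Unique is →
                All (λ i → f (element i) ≈ 0#) is → length is ≤ d
  roots-bound p l≉0 [] u fs = z≤n
  roots-bound (const f≈l) l≉0 (i ∷ is) u (fi ∷ fs) = ⊥-elim (l≉0 (trans (sym (f≈l _)) fi))
  roots-bound {f = f} p@(horner _ _ _) l≉0 (i ∷ is) (i∉is ∷ u) (fi ∷ fs) with poly-divide p (element i)
  ... | g , pg , f≈ = s≤s (roots-bound pg l≉0 is u (All.zipWith root (i∉is , fs)))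
    where
    root : ∀ {j} → i ≢ j × f (element j) ≈ 0# → g (element j) ≈ 0#
    root {j} (i≢j , fj) = *-cancel-≉0 (≉⇒-≉0 (λ eq → i≢j (≡.sym (element-injective eq)))) (begin
      (element j - element i) * g (element j)                  ≈⟨ +-identityʳ _ ⟨
      (element j - element i) * g (element j) + 0#             ≈⟨ +-congˡ fi ⟨
      (element j - element i) * g (element j) + f (element i)  ≈⟨ f≈ _ ⟨
      f (element j)                                            ≈⟨ fj ⟩
      0#                                                       ∎)

  geometricSum : ℕ → Carrier → Carrier
  geometricSum zero    y = 0#
  geometricSum (suc n) y = y * geometricSum n y + 1#

  *-geometricSum : ∀ n y → (y - 1#) * geometricSum n y ≈ y ^ n - 1#
  *-geometricSum zero    y = trans (zeroʳ _) (sym (-‿inverseʳ _))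
  *-geometricSum (suc n) y = begin
    (y - 1#) * (y * geometricSum n y + 1#)          ≈⟨ solve 3 (λ y g e → (y :- e) :* (y :* g :+ e) := y :* ((y :- e) :* g) :+ (y :- e) :* e)
                                                         refl y (geometricSum n y) 1# ⟩
    y * ((y - 1#) * geometricSum n y) + (y - 1#) * 1# ≈⟨ +-cong (*-congˡ (*-geometricSum n y)) (*-identityʳ _) ⟩
    y * (y ^ n - 1#) + (y - 1#)                     ≈⟨ +-congʳ (trans (distribˡ _ _ _) (+-congˡ (trans (sym (-‿distribʳ-* y 1#)) (-‿cong (*-identityʳ y))))) ⟩
    y * y ^ n - y + (y - 1#)                        ≈⟨ solve 3 (λ z y e → z :- y :+ (y :- e) := z :- e) refl (y * y ^ n) y 1# ⟩
    y * y ^ n - 1#                                  ∎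
    where open import Algebra.Properties.Ring ring using (-‿distribʳ-*)

  -- With y = x^(r + 1) this is (y^(n + 1) - 1)/(y - 1); it serves as the cofactor of x (y - 1) in
  -- x^q - x.
  poly-geometricSum : ∀ r n → Poly (suc r ℕ.* n) 1# (λ x → geometricSum (suc n) (x ^ suc r))
  poly-geometricSum r zero = poly-degree (≡.sym (ℕₚ.*-zeroʳ r))
    (const (λ x → trans (+-congʳ (zeroʳ _)) (+-identityˡ _)))
  poly-geometricSum r (suc n) = poly-degree (≡.sym (ℕₚ.*-suc (suc r) n))
    (poly-+-const 1# (poly-shift (suc r) (poly-geometricSum r n)))

-- Put q' = r + 2 and m = (q - 1)/(q' - 1). The factor x contributes one root and the cofactor (q' -
-- 1)(m - 1) = q - q' roots, so the bound on `b` is q - (q' - 1).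
complement-bound : ∀ {a b q} r R → q ≡ suc (suc r) ℕ.^ suc R → a ℕ.+ b ≡ q →
                   b ≤ suc (suc r ℕ.* (suc (suc r) ℕ.* geometric (suc r) R)) → suc r ≤ a
complement-bound {a} {b} {q} r R q≡ a+b≡q b≤ = ℕₚ.+-cancelʳ-≤ _ _ _ (begin
  suc r ℕ.+ suc (suc r ℕ.* (suc (suc r) ℕ.* geometric (suc r) R))  ≡⟨ ℕₚ.+-suc (suc r) _ ⟩
  suc (suc r ℕ.+ suc r ℕ.* (suc (suc r) ℕ.* geometric (suc r) R))  ≡⟨ ≡.cong suc (ℕₚ.*-suc (suc r) _) ⟨
  suc (suc r ℕ.* geometric (suc r) (suc R))                        ≡⟨ suc-*-geometric (suc r) (suc R) ⟩
  suc (suc r) ℕ.^ suc R                                            ≡⟨ ≡.trans (≡.sym q≡) (≡.sym a+b≡q) ⟩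
  a ℕ.+ b                                                          ≤⟨ ℕₚ.+-monoʳ-≤ a b≤ ⟩
  a ℕ.+ suc (suc r ℕ.* (suc (suc r) ℕ.* geometric (suc r) R))      ∎)
  where open ℕₚ.≤-Reasoning

-- The subfield of order q' = r + 2 in K, of degree `suc R`

module Subfield {c ℓ : Level} (K : CommutativeRing c ℓ) (isField : IsField K)
                (q : ℕ) (order : HasOrder K q)
                (p k R r : ℕ) (pr : Prime p) (pᵏ≡2+r : p ℕ.^ k ≡ suc (suc r))
                (q≡[2+r]^R : q ≡ suc (suc r) ℕ.^ suc R) where

  open CommutativeRing K hiding (zero)
  open IntegerSolver K
  open FieldProperties K isField q order
  open Polynomials K isField q order
  open import Algebra.Properties.Semiring.Mult semiring as Mult using ()
  open import Algebra.Properties.CommutativeMonoid.Sum *-commutativeMonoid as Prod using ()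
  open import Algebra.Properties.CommutativeSemiring.Binomial commutativeSemiring as Binomial using (binomialTerm)
  open import Relation.Binary.Reasoning.Setoid setoid

  ×1-homo-^ : ∀ m n → (m ℕ.^ n) Mult.× 1# ≈ (m Mult.× 1#) ^ n
  ×1-homo-^ m zero    = +-identityʳ 1#
  ×1-homo-^ m (suc n) = trans (Mult.×1-homo-* m (m ℕ.^ n)) (*-congˡ (×1-homo-^ m n))

  -- The multiple q of 1 vanishes and is a power of the multiple `p` of 1; a field has no nilpotent
  -- elements besides 0.
  characteristic : p Mult.× 1# ≈ 0#
  characteristic = ^-≈0 _ k (trans (sym (×1-homo-^ p k)) (^-≈0 _ (suc R) (begin
    ((p ℕ.^ k) Mult.× 1#) ^ suc R    ≈⟨ ×1-homo-^ (p ℕ.^ k) (suc R) ⟨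
    ((p ℕ.^ k) ℕ.^ suc R) Mult.× 1#  ≡⟨ ≡.cong (λ n → (n ℕ.^ suc R) Mult.× 1#) pᵏ≡2+r ⟩
    (suc (suc r) ℕ.^ suc R) Mult.× 1# ≡⟨ ≡.cong (Mult._× 1#) q≡[2+r]^R ⟨
    q Mult.× 1#                      ≈⟨ order×1≈0 ⟩
    0#                               ∎)))

  p∣n⇒n×x≈0 : ∀ {n} → p ∣ n → ∀ x → n Mult.× x ≈ 0#
  p∣n⇒n×x≈0 {n} (divides d n≡dp) x = begin
    n Mult.× x                        ≡⟨ ≡.cong (Mult._× x) (≡.trans n≡dp (ℕₚ.*-comm d p)) ⟩
    (p ℕ.* d) Mult.× x                ≈⟨ Mult.×-assocˡ x p d ⟨
    p Mult.× (d Mult.× x)             ≈⟨ Mult.×-congʳ p (*-identityˡ _) ⟨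
    p Mult.× (1# * (d Mult.× x))      ≈⟨ Mult.×-assoc-* p 1# _ ⟨
    (p Mult.× 1#) * (d Mult.× x)      ≈⟨ *-congʳ characteristic ⟩
    0# * (d Mult.× x)                 ≈⟨ zeroˡ _ ⟩
    0#                                ∎

  -- All inner binomial coefficients are divisible by `p`. Writing `p` as a successor exposes the
  -- two outer terms of the expansion.
  frobenius-suc : ∀ n → p ≡ suc n → ∀ x y → (x + y) ^ suc n ≈ x ^ suc n + y ^ suc n
  frobenius-suc n p≡1+n x y = begin
    (x + y) ^ suc n                     ≈⟨ Binomial.theorem (suc n) x y ⟩
    sum t                               ≈⟨ sum-init-last t ⟩
    t zero + sum {n} (t ∘ suc ∘ inject₁) + t (fromℕ (suc n))
                                        ≈⟨ +-cong (+-cong first (sum-zero +-commutativeMonoid _ middle)) last ⟩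
    y ^ suc n + 0# + x ^ suc n          ≈⟨ trans (+-congʳ (+-identityʳ _)) (+-comm _ _) ⟩
    x ^ suc n + y ^ suc n               ∎
    where
    t : Fin (suc (suc n)) → Carrier
    t = binomialTerm x y (suc n)
    first : t zero ≈ y ^ suc n
    first = begin
      (suc n C 0) Mult.× (1# * y ^ suc n)  ≡⟨ ≡.cong (Mult._× (1# * y ^ suc n)) (≡.trans (nCk≡nC[n∸k] {0} {suc n} z≤n) (nCn≡1 (suc n))) ⟩
      1 Mult.× (1# * y ^ suc n)            ≈⟨ trans (+-identityʳ _) (*-identityˡ _) ⟩
      y ^ suc n                            ∎
    last : t (fromℕ (suc n)) ≈ x ^ suc n
    last = begin
      (suc n C toℕ (fromℕ (suc n))) Mult.× (x ^ toℕ (fromℕ (suc n)) * y ^ (suc n ∸ toℕ (fromℕ (suc n))))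
        ≡⟨ ≡.cong (λ m → (suc n C m) Mult.× (x ^ m * y ^ (suc n ∸ m))) (Finₚ.toℕ-fromℕ (suc n)) ⟩
      (suc n C suc n) Mult.× (x ^ suc n * y ^ (n ∸ n))
        ≡⟨ ≡.cong₂ (λ a b → a Mult.× (x ^ suc n * y ^ b)) (nCn≡1 (suc n)) (ℕₚ.n∸n≡0 n) ⟩
      1 Mult.× (x ^ suc n * 1#)
        ≈⟨ trans (+-identityʳ _) (*-identityʳ _) ⟩
      x ^ suc n ∎
    middle : ∀ i → t (suc (inject₁ i)) ≈ 0#
    middle i = p∣n⇒n×x≈0 (≡.subst (λ m → p ∣ m C suc (toℕ (inject₁ i))) p≡1+n (prime∣C pr (s≤s z≤n) 1+i<p)) _
      where
      1+i<p : suc (toℕ (inject₁ i)) < p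
      1+i<p rewrite p≡1+n | Finₚ.toℕ-inject₁ i = s≤s (Finₚ.toℕ<n i)

  frobenius : ∀ x y → (x + y) ^ p ≈ x ^ p + y ^ p
  frobenius x y with ℕ.pred p | ℕₚ.suc-pred p {{ℕ.nonTrivial⇒nonZero p {{prime⇒nonTrivial pr}}}}
  ... | n | 1+n≡p = begin
    (x + y) ^ p            ≡⟨ ≡.cong ((x + y) ^_) 1+n≡p ⟨
    (x + y) ^ suc n        ≈⟨ frobenius-suc n (≡.sym 1+n≡p) x y ⟩
    x ^ suc n + y ^ suc n  ≡⟨ ≡.cong (λ m → x ^ m + y ^ m) 1+n≡p ⟩
    x ^ p + y ^ p          ∎

  frobenius-iterate : ∀ n x y → (x + y) ^ (p ℕ.^ n) ≈ x ^ (p ℕ.^ n) + y ^ (p ℕ.^ n)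
  frobenius-iterate zero    x y = trans (*-identityʳ _) (sym (+-cong (*-identityʳ x) (*-identityʳ y)))
  frobenius-iterate (suc n) x y = begin
    (x + y) ^ (p ℕ.* p ℕ.^ n)                  ≈⟨ ^-assocʳ (x + y) p _ ⟨
    ((x + y) ^ p) ^ (p ℕ.^ n)                  ≈⟨ ^-congˡ (p ℕ.^ n) (frobenius x y) ⟩
    (x ^ p + y ^ p) ^ (p ℕ.^ n)                ≈⟨ frobenius-iterate n (x ^ p) (y ^ p) ⟩
    (x ^ p) ^ (p ℕ.^ n) + (y ^ p) ^ (p ℕ.^ n)  ≈⟨ +-cong (^-assocʳ x p _) (^-assocʳ y p _) ⟩
    x ^ (p ℕ.* p ℕ.^ n) + y ^ (p ℕ.* p ℕ.^ n)  ∎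

  product-≉0 : ∀ {n} (f : Fin n → Carrier) → (∀ i → f i ≉0) → Prod.sum f ≉0
  product-≉0 {zero}  f f≉0 = 1≉0
  product-≉0 {suc n} f f≉0 = *-≉0 (f≉0 zero) (product-≉0 (f ∘ suc) (f≉0 ∘ suc))

  -- Replacing 0 by 1 turns a product over the whole field into the product of its nonzero elements.
  nonzeroPart : Carrier → Carrier
  nonzeroPart x with x ≟ 0#
  ... | yes _ = 1#
  ... | no  _ = x

  nonzeroPart-≉0 : ∀ x → nonzeroPart x ≉0
  nonzeroPart-≉0 x with x ≟ 0#
  ... | yes _   = 1≉0
  ... | no  x≉0 = x≉0

  -- Multiplication by a ≠ 0 permutes the field; comparing the products of the
  -- nonzero parts of x and of a x over all x gives a^(q-1) = 1.
  fermat-≉0 : ∀ {a} → a ≉0 → a ^ q ≈ a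
  fermat-≉0 {a} a≉0 = sym (*-injectiveˡ (product-≉0 f (λ i → nonzeroPart-≉0 (element i))) (trans (*-comm _ _) (trans (begin
    a * Prod.sum f                        ≈⟨ *-congʳ (trans (sum-single *-commutativeMonoid g (index 0#) g≈1) g≈a) ⟨
    Prod.sum g * Prod.sum f               ≈⟨ *-congˡ (Prod.sum-permute f scale) ⟩
    Prod.sum g * Prod.sum (λ i → nonzeroPart (element (index (a * element i))))
                                          ≈⟨ Prod.∑-distrib-+ g _ ⟨
    Prod.sum (λ i → g i * nonzeroPart (element (index (a * element i))))
                                          ≈⟨ Prod.sum-cong-≋ pointwise ⟩
    Prod.sum (λ i → a * f i)              ≈⟨ Prod.∑-distrib-+ (λ _ → a) f ⟩
    Prod.sum {q} (λ _ → a) * Prod.sum f   ≈⟨ *-congʳ (Prod.sum-replicate q) ⟩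
    a ^ q * Prod.sum f                    ∎) (*-comm _ _))))
    where
    f g : Fin q → Carrier
    f i = nonzeroPart (element i)
    -- At 0 scaling contributes no factor `a`; `g` supplies it, so that all q positions give one
    -- factor each and a^q appears instead of a^(q-1).
    g i with element i ≟ 0#
    ... | yes _ = a
    ... | no  _ = 1#
    g≈1 : ∀ j → j ≢ index 0# → g j ≈ 1#
    g≈1 j j≢0 with element j ≟ 0#
    ... | yes eq = ⊥-elim (j≢0 (≡.trans (≡.sym (index-element j)) (index-cong eq)))
    ... | no  _  = refl
    g≈a : g (index 0#) ≈ a
    g≈a with element (index 0#) ≟ 0#
    ... | yes _ = refl
    ... | no  e = ⊥-elim (e (element-index 0#))
    scale : Perm.Permutation q q
    scale = permutation (a *_) (recip a *_) *-congˡ *-congˡ (λ x → *-recip-cancelˡ x a≉0)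
      (λ x → trans (solve 3 (λ a b x → b :* (a :* x) := a :* (b :* x)) refl a (recip a) x) (*-recip-cancelˡ x a≉0))
    pointwise : ∀ i → g i * nonzeroPart (element (index (a * element i))) ≈ a * f i
    pointwise i with element i ≟ 0# | element (index (a * element i)) ≟ 0#
    ... | yes _  | yes _ = refl
    ... | no _   | no _  = trans (*-identityˡ _) (element-index _)
    ... | yes e  | no ne = ⊥-elim (ne (trans (element-index _) (trans (*-congˡ e) (zeroʳ a))))
    ... | no ne  | yes e = ⊥-elim (*-≉0 a≉0 ne (trans (sym (element-index _)) e))

  fermat : ∀ a → a ^ q ≈ a
  fermat a with a ≟ 0#
  ... | no a≉0  = fermat-≉0 a≉0
  ... | yes a≈0 = begin
    a ^ q                              ≡⟨ ≡.cong (a ^_) (≡.trans q≡[2+r]^R (≡.sym (suc-*-geometric (suc r) (suc R)))) ⟩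
    a * a ^ (suc r ℕ.* geometric (suc r) (suc R))  ≈⟨ *-congʳ a≈0 ⟩
    0# * _                             ≈⟨ zeroˡ _ ⟩
    0#                                 ≈⟨ a≈0 ⟨
    a                                  ∎

  isUnit? : Decidable₁ (λ i → element i ^ suc r ≈ 1#)
  isUnit? i = element i ^ suc r ≟ 1#

  units : List (Fin q)
  units = filter isUnit? (allFin q)

  units-unique : Unique units
  units-unique = filter⁺ isUnit? (allFin⁺ q)

  length-units-≤ : length units ≤ suc r
  length-units-≤ = roots-bound (poly-+-const (- 1#) (poly-^ (suc r))) 1≉0 units units-unique
    (All.map x≈y⇒x-y≈0 (Allₚ.all-filter isUnit? (allFin q)))

  -- With y = x^(q' - 1) and m = (q - 1)/(q' - 1), `fermat` says that x (y - 1)(1 + y + ... +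
  -- y^(m-1)) = x^q - x vanishes everywhere. For a non-unit y - 1 can be cancelled, leaving a root
  -- of the rest.
  length-nonunits-≤ : length (filter (¬? ∘ isUnit?) (allFin q)) ≤ suc (suc r ℕ.* (suc (suc r) ℕ.* geometric (suc r) R))
  length-nonunits-≤ = roots-bound (horner 0# (poly-geometricSum r _) (λ x → sym (+-identityʳ _))) 1≉0 _
    (filter⁺ (¬? ∘ isUnit?) (allFin⁺ q)) (All.map root (Allₚ.all-filter (¬? ∘ isUnit?) (allFin q)))
    where
    root : ∀ {i} → ¬ (element i ^ suc r ≈ 1#) →
           element i * geometricSum (geometric (suc r) (suc R)) (element i ^ suc r) ≈ 0#
    root {i} ne = *-cancel-≉0 (≉⇒-≉0 ne) (begin
      (y - 1#) * (x * geometricSum m y)    ≈⟨ solve 3 (λ d x g → d :* (x :* g) := x :* (d :* g)) refl (y - 1#) x _ ⟩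
      x * ((y - 1#) * geometricSum m y)    ≈⟨ *-congˡ (*-geometricSum m y) ⟩
      x * (y ^ m - 1#)                     ≈⟨ solve 3 (λ x z e → x :* (z :- e) := x :* z :- x :* e) refl x (y ^ m) 1# ⟩
      x * y ^ m - x * 1#                   ≈⟨ +-cong (*-congˡ (^-assocʳ x (suc r) m)) (-‿cong (*-identityʳ x)) ⟩
      x ^ suc (suc r ℕ.* m) - x            ≡⟨ ≡.cong (λ n → x ^ n - x) (≡.trans (suc-*-geometric (suc r) (suc R)) (≡.sym q≡[2+r]^R)) ⟩
      x ^ q - x                            ≈⟨ x≈y⇒x-y≈0 (fermat x) ⟩
      0#                                   ∎)
      where
      x y : Carrier
      x = element i
      y = x ^ suc r
      m : ℕ
      m = geometric (suc r) (suc R)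

  -- The two degree bounds for units and non-units add up to q, so both are attained.
  length-units : length units ≡ suc r
  length-units = ℕₚ.≤-antisym length-units-≤ (complement-bound r R q≡[2+r]^R
    (≡.trans (length-filter-∁ isUnit? (allFin q)) (Listₚ.length-tabulate id)) length-nonunits-≤)

  abstract
    unit : Fin (suc r) → Carrier
    unit i = element (lookup units (Fin.cast (≡.sym length-units) i))

    unit-injective : ∀ {i j} → unit i ≈ unit j → i ≡ j
    unit-injective eq = Finₚ.toℕ-injective (≡.trans (≡.sym (Finₚ.toℕ-cast _ _)) (≡.trans
      (≡.cong toℕ (lookup-injective id units-unique _ _ (element-injective eq))) (Finₚ.toℕ-cast _ _)))

    unit^ : ∀ i → unit i ^ suc r ≈ 1#
    unit^ i = All.lookup (Allₚ.all-filter isUnit? (allFin q)) (∈-lookup (Fin.cast (≡.sym length-units) i))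

    unit-surjective : ∀ {x} → x ^ suc r ≈ 1# → ∃ λ i → unit i ≈ x
    unit-surjective {x} x^≈1 = Fin.cast length-units (Any.index x∈) , trans (reflexive (≡.cong element (≡.trans
        (≡.cong (lookup units) (Finₚ.cast-involutive (≡.sym length-units) length-units (Any.index x∈)))
        (≡.sym (lookup-index x∈))))) (element-index x)
      where
      x∈ : index x ∈ units
      x∈ = ∈-filter⁺ isUnit? (∈-allFin (index x)) (trans (^-congˡ (suc r) (element-index x)) x^≈1)

  unit-≉0 : ∀ i → unit i ≉0
  unit-≉0 i eq = 1≉0 (trans (sym (unit^ i)) (trans (*-congʳ eq) (zeroˡ _)))

  -- With 0 numbered first, nonzero scalars are recognised by the constructor `suc`; the points of
  -- an edge are indexed in this way later.
  scalar : Fin (suc (suc r)) → Carrier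
  scalar zero    = 0#
  scalar (suc i) = unit i

  scalar-injective : ∀ {i j} → scalar i ≈ scalar j → i ≡ j
  scalar-injective {zero}  {zero}  eq = ≡.refl
  scalar-injective {zero}  {suc j} eq = ⊥-elim (unit-≉0 j (sym eq))
  scalar-injective {suc i} {zero}  eq = ⊥-elim (unit-≉0 i eq)
  scalar-injective {suc i} {suc j} eq = ≡.cong suc (unit-injective eq)

  Scalar : Carrier → Set ℓ
  Scalar x = x ^ suc (suc r) ≈ x

  abstract
    scalar-surjective : ∀ {x} → Scalar x → ∃ λ i → scalar i ≈ x
    scalar-surjective {x} x∈F = [ (λ x≈0 → zero , sym x≈0)
                                , (λ eq → let i , i≈x = unit-surjective (x-y≈0⇒x≈y eq) in suc i , i≈x)
                                ]′ (zero-product x (x ^ suc r - 1#) (begin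
      x * (x ^ suc r - 1#)      ≈⟨ solve 3 (λ x y e → x :* (y :- e) := x :* y :- x :* e) refl x (x ^ suc r) 1# ⟩
      x * x ^ suc r - x * 1#    ≈⟨ +-congˡ (-‿cong (*-identityʳ x)) ⟩
      x * x ^ suc r - x         ≈⟨ x≈y⇒x-y≈0 x∈F ⟩
      0#                        ∎))

  scalar-Scalar : ∀ i → Scalar (scalar i)
  scalar-Scalar zero    = zeroˡ _
  scalar-Scalar (suc i) = trans (*-congˡ (unit^ i)) (*-identityʳ _)

  Scalar-resp : ∀ {x y} → x ≈ y → Scalar x → Scalar y
  Scalar-resp x≈y x∈F = trans (^-congˡ (suc (suc r)) (sym x≈y)) (trans x∈F x≈y)

  0∈F : Scalar 0#
  0∈F = zeroˡ _

  1∈F : Scalar 1#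
  1∈F = 1^n≈1 (suc (suc r))

  +-∈F : ∀ {x y} → Scalar x → Scalar y → Scalar (x + y)
  +-∈F {x} {y} x∈F y∈F = begin
    (x + y) ^ suc (suc r)              ≡⟨ ≡.cong ((x + y) ^_) pᵏ≡2+r ⟨
    (x + y) ^ (p ℕ.^ k)                ≈⟨ frobenius-iterate k x y ⟩
    x ^ (p ℕ.^ k) + y ^ (p ℕ.^ k)      ≡⟨ ≡.cong (λ m → x ^ m + y ^ m) pᵏ≡2+r ⟩
    x ^ suc (suc r) + y ^ suc (suc r)  ≈⟨ +-cong x∈F y∈F ⟩
    x + y                              ∎

  *-∈F : ∀ {x y} → Scalar x → Scalar y → Scalar (x * y)
  *-∈F {x} {y} x∈F y∈F = trans (^-distrib-* x y (suc (suc r))) (*-cong x∈F y∈F)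

  -- Additivity of the q'-th power, applied to - x + x = 0, avoids a distinction between even and
  -- odd q'.
  -‿∈F : ∀ {x} → Scalar x → Scalar (- x)
  -‿∈F {x} x∈F = begin
    n ^ suc (suc r)                    ≈⟨ solve 2 (λ n x → n := (n :+ x) :- x) refl (n ^ suc (suc r)) (x ^ suc (suc r)) ⟩
    n ^ suc (suc r) + x ^ suc (suc r) - x ^ suc (suc r)
                                       ≈⟨ +-cong n+x (-‿cong x∈F) ⟩
    0# - x                             ≈⟨ +-identityˡ _ ⟩
    - x                                ∎
    where
    n : Carrier
    n = - x
    n+x : n ^ suc (suc r) + x ^ suc (suc r) ≈ 0#
    n+x = begin
      n ^ suc (suc r) + x ^ suc (suc r)  ≡⟨ ≡.cong (λ m → n ^ m + x ^ m) pᵏ≡2+r ⟨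
      n ^ (p ℕ.^ k) + x ^ (p ℕ.^ k)      ≈⟨ frobenius-iterate k n x ⟨
      (n + x) ^ (p ℕ.^ k)                ≡⟨ ≡.cong ((n + x) ^_) pᵏ≡2+r ⟩
      (n + x) ^ suc (suc r)              ≈⟨ ^-congˡ (suc (suc r)) (-‿inverseˡ x) ⟩
      0# ^ suc (suc r)                   ≈⟨ 0∈F ⟩
      0#                                 ∎

  recip-∈F : ∀ {x} → x ≉0 → Scalar x → Scalar (recip x)
  recip-∈F {x} x≉0 x∈F = *-injectiveˡ x≉0 (begin
    x * recip x ^ suc (suc r)                ≈⟨ *-congʳ x∈F ⟨
    x ^ suc (suc r) * recip x ^ suc (suc r)  ≈⟨ ^-distrib-* x (recip x) (suc (suc r)) ⟨
    (x * recip x) ^ suc (suc r)              ≈⟨ ^-congˡ (suc (suc r)) (*-recip x≉0) ⟩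
    1# ^ suc (suc r)                         ≈⟨ 1∈F ⟩
    1#                                       ≈⟨ *-recip x≉0 ⟨
    x * recip x                              ∎)

  sum-∈F : ∀ {n} (f : Fin n → Carrier) → (∀ i → Scalar (f i)) → Scalar (sum f)
  sum-∈F {zero}  f f∈F = 0∈F
  sum-∈F {suc n} f f∈F = +-∈F (f∈F zero) (sum-∈F (f ∘ suc) (f∈F ∘ suc))

-- Linear algebra over the subfield, by counting

funToFin-cong : ∀ {m n} {f g : Fin m → Fin n} → (∀ i → f i ≡ g i) → funToFin f ≡ funToFin g
funToFin-cong {zero}  f≗g = ≡.refl
funToFin-cong {suc m} f≗g = ≡.cong₂ Fin.combine (f≗g zero) (funToFin-cong (f≗g ∘ suc))

collision : ∀ {m n b} → m < b ℕ.^ n → (f : (Fin n → Fin b) → Fin m) →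
            ∃₂ λ d d′ → f d ≡ f d′ × ∃ λ i → d i ≢ d′ i
collision {m} {n} {b} m<bⁿ f with Finₚ.pigeonhole m<bⁿ (f ∘ finToFun)
... | e , e′ , e<e′ , eq with Finₚ.any? (λ i → ¬? (finToFun {b} {n} e i Fin.≟ finToFun e′ i))
...   | yes differ = finToFun e , finToFun e′ , eq , differ
...   | no  agree  = ⊥-elim (Finₚ.<⇒≢ e<e′ (≡.trans (≡.sym (Finₚ.funToFin-finToFin {n} e)) (≡.trans
        (funToFin-cong (λ i → decidable-stable (_ Fin.≟ _) (λ ne → agree (i , ne)))) (Finₚ.funToFin-finToFin {n} e′))))

module LinearAlgebra {c ℓ : Level} (K : CommutativeRing c ℓ) (isField : IsField K)
                (q : ℕ) (order : HasOrder K q)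
                (p k R r : ℕ) (pr : Prime p) (pᵏ≡2+r : p ℕ.^ k ≡ suc (suc r))
                (q≡[2+r]^R : q ≡ suc (suc r) ℕ.^ suc R) where

  open CommutativeRing K hiding (zero)
  open IntegerSolver K
  open FieldProperties K isField q order
  open Subfield K isField q order p k R r pr pᵏ≡2+r q≡[2+r]^R
  open import Relation.Binary.Reasoning.Setoid setoid

  linear : ∀ {n} → (Fin n → Carrier) → (Fin n → Carrier) → Carrier
  linear c v = sum (λ i → c i * v i)

  linear-difference : ∀ {n} (c d v : Fin n → Carrier) → linear c v ≈ linear d v → linear (λ i → c i - d i) v ≈ 0#
  linear-difference {n} c d v eq = begin
    linear (λ i → c i - d i) v                       ≈⟨ sum-cong-≋ (λ i → solve 3 (λ c d v → (c :- d) :* v := c :* v :+ (:- :1) :* (d :* v)) refl (c i) (d i) (v i)) ⟩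
    sum (λ i → c i * v i + - 1# * (d i * v i))       ≈⟨ ∑-distrib-+ (λ i → c i * v i) _ ⟩
    linear c v + sum (λ i → - 1# * (d i * v i))      ≈⟨ +-congˡ (*-distribˡ-sum (- 1#) (λ i → d i * v i)) ⟨
    linear c v + - 1# * linear d v                   ≈⟨ solve 2 (λ x y → x :+ (:- :1) :* y := x :- y) refl _ _ ⟩
    linear c v - linear d v                          ≈⟨ x≈y⇒x-y≈0 eq ⟩
    0#                                               ∎

  abstract
    digit : ∀ {x} → Scalar x → Fin (suc (suc r))
    digit x∈F = proj₁ (scalar-surjective x∈F)

    scalar-digit : ∀ {x} (x∈F : Scalar x) → scalar (digit x∈F) ≈ x
    scalar-digit x∈F = proj₂ (scalar-surjective x∈F)

  NonZeroVector : ∀ {n} → (Fin n → Carrier) → Set ℓ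
  NonZeroVector c = ∃ λ i → c i ≉0

  scalars-differ : ∀ {n} (d d′ : Fin n → Fin (suc (suc r))) → (∃ λ i → d i ≢ d′ i) →
                   NonZeroVector (λ i → scalar (d i) - scalar (d′ i))
  scalars-differ d d′ (i , ne) = i , ≉⇒-≉0 (ne ∘ scalar-injective)

  scalars-difference-∈F : ∀ {n} (d d′ : Fin n → Fin (suc (suc r))) i → Scalar (scalar (d i) - scalar (d′ i))
  scalars-difference-∈F d d′ i = +-∈F (scalar-Scalar (d i)) (-‿∈F (scalar-Scalar (d′ i)))

  dependent : ∀ {n} (v : Fin n → Carrier) → q < suc (suc r) ℕ.^ n →
              ∃ λ c → (∀ i → Scalar (c i)) × NonZeroVector c × linear c v ≈ 0#
  dependent v q<q′ⁿ =
    let d , d′ , eq , differ = collision q<q′ⁿ (λ d → index (linear (scalar ∘ d) v)) in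
    (λ i → scalar (d i) - scalar (d′ i)) , scalars-difference-∈F d d′ , scalars-differ d d′ differ ,
                               linear-difference (scalar ∘ d) (scalar ∘ d′) v (index-injective eq)

  -- Since the entries lie in F, the q'^n row combinations take at most q'^m values, and two that
  -- collide have a difference that kills every column.
  kernel : ∀ {n m} (H : Fin n → Fin m → Carrier) → (∀ i j → Scalar (H i j)) → m < n →
           ∃ λ c → (∀ i → Scalar (c i)) × NonZeroVector c × (∀ j → linear c (λ i → H i j) ≈ 0#)
  kernel {n} {m} H H∈F m<n =
    let d , d′ , eq , differ = collision (ℕₚ.^-monoʳ-< (suc (suc r)) (s≤s (s≤s z≤n)) m<n) (λ d → funToFin (image d)) in
    (λ i → scalar (d i) - scalar (d′ i)) , scalars-difference-∈F d d′ , scalars-differ d d′ differ , λ j →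
    linear-difference (scalar ∘ d) (scalar ∘ d′) (λ i → H i j) (begin
      linear (scalar ∘ d) (λ i → H i j)   ≈⟨ scalar-digit (image-∈F d j) ⟨
      scalar (image d j)                  ≡⟨ ≡.cong scalar (Finₚ.finToFun-funToFin (image d) j) ⟨
      scalar (finToFun (funToFin (image d)) j)   ≡⟨ ≡.cong (λ e → scalar (finToFun e j)) eq ⟩
      scalar (finToFun (funToFin (image d′)) j)  ≡⟨ ≡.cong scalar (Finₚ.finToFun-funToFin (image d′) j) ⟩
      scalar (image d′ j)                 ≈⟨ scalar-digit (image-∈F d′ j) ⟩
      linear (scalar ∘ d′) (λ i → H i j)  ∎)
    where
    image-∈F : ∀ (d : Fin n → Fin (suc (suc r))) j → Scalar (linear (scalar ∘ d) (λ i → H i j))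
    image-∈F d j = sum-∈F (λ i → scalar (d i) * H i j) (λ i → *-∈F (scalar-Scalar (d i)) (H∈F i j))
    image : (Fin n → Fin (suc (suc r))) → Fin m → Fin (suc (suc r))
    image d j = digit (image-∈F d j)

  Independent : ∀ {n} → (Fin n → Carrier) → Set (c ⊔ ℓ)
  Independent {n} v = ∀ c → (∀ i → Scalar (c i)) → linear c v ≈ 0# → ∀ i → c i ≈ 0#

  unreached : ∀ {m} → m < q → (f : Fin m → Fin q) → ∃ λ x → ¬ ∃ λ i → f i ≡ x
  unreached {m} m<q f = Finₚ.¬∀⟶∃¬ q (λ x → ∃ λ i → f i ≡ x) (λ x → Finₚ.any? (λ i → f i Fin.≟ x)) λ surjective →
    ℕₚ.<⇒≱ m<q (Finₚ.injective⇒≤ {f = proj₁ ∘ surjective} λ {x} {y} eq →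
      ≡.trans (≡.sym (proj₂ (surjective x))) (≡.trans (≡.cong f eq) (proj₂ (surjective y))))

  cons : ∀ {n} → Carrier → (Fin n → Carrier) → Fin (suc n) → Carrier
  cons x v zero    = x
  cons x v (suc i) = v i

  solve-for-head : ∀ {n} x (v : Fin n → Carrier) c → c zero ≉0 → linear c (cons x v) ≈ 0# →
                   linear (λ i → - (recip (c zero) * c (suc i))) v ≈ x
  solve-for-head x v c c₀≉0 eq = *-injectiveˡ c₀≉0 (begin
    c zero * linear (λ i → - (recip (c zero) * c (suc i))) v
      ≈⟨ *-distribˡ-sum (c zero) (λ i → - (recip (c zero) * c (suc i)) * v i) ⟩
    sum (λ i → c zero * (- (recip (c zero) * c (suc i)) * v i))
      ≈⟨ sum-cong-≋ (λ i → trans (solve 4 (λ a b c v → a :* (:- (b :* c) :* v) := (:- v) :* (a :* (b :* c)))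
            refl (c zero) (recip (c zero)) (c (suc i)) (v i))
            (trans (*-congˡ (*-recip-cancelˡ (c (suc i)) c₀≉0))
              (solve 2 (λ c v → (:- v) :* c := (:- :1) :* (c :* v)) refl (c (suc i)) (v i)))) ⟩
    sum (λ i → - 1# * (c (suc i) * v i))
      ≈⟨ *-distribˡ-sum (- 1#) (λ i → c (suc i) * v i) ⟨
    - 1# * linear (c ∘ suc) v
      ≈⟨ solve 2 (λ s t → (:- :1) :* s := t :- (t :+ s)) refl (linear (c ∘ suc) v) (c zero * x) ⟩
    c zero * x - (c zero * x + linear (c ∘ suc) v)
      ≈⟨ +-congˡ (-‿cong eq) ⟩
    c zero * x - 0#
      ≈⟨ solve 1 (λ a → a :- :0 := a) refl (c zero * x) ⟩
    c zero * x ∎)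

  drop-head : ∀ {n} x (v : Fin n → Carrier) c → c zero ≈ 0# → linear c (cons x v) ≈ 0# → linear (c ∘ suc) v ≈ 0#
  drop-head x v c c₀≈0 eq = begin
    linear (c ∘ suc) v                 ≈⟨ +-identityˡ _ ⟨
    0# + linear (c ∘ suc) v            ≈⟨ +-congʳ (trans (*-congʳ c₀≈0) (zeroˡ _)) ⟨
    c zero * x + linear (c ∘ suc) v    ≈⟨ eq ⟩
    0#                                 ∎

  InSpan : ∀ {n} → (Fin n → Carrier) → Carrier → Set (c ⊔ ℓ)
  InSpan v x = ∃ λ b → (∀ i → Scalar (b i)) × linear b v ≈ x

  cons-independent : ∀ {n} x (v : Fin n → Carrier) → Independent v → ¬ InSpan v x → Independent (cons x v)
  cons-independent x v indep x∉span c c∈F eq with c zero ≟ 0#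
  ... | yes c₀≈0 = λ { zero → c₀≈0 ; (suc i) → indep (c ∘ suc) (c∈F ∘ suc) (drop-head x v c c₀≈0 eq) i }
  ... | no  c₀≉0 = ⊥-elim (x∉span (_ , (λ i → -‿∈F (*-∈F (recip-∈F c₀≉0 (c∈F zero)) (c∈F (suc i))))
                                     , solve-for-head x v c c₀≉0 eq))

  -- The span over F has at most q'^n elements, so some element of K lies outside it.
  extend-independent : ∀ {n} (v : Fin n → Carrier) → Independent v → suc (suc r) ℕ.^ n < q →
                       ∃ λ (w : Fin (suc n) → Carrier) → Independent w
  extend-independent {n} v indep q′ⁿ<q =
    let x , unreachable = unreached q′ⁿ<q span in
    cons (element x) v , cons-independent (element x) v indep λ { (b , b∈F , b·v≈x) → unreachable
      (funToFin (λ i → digit (b∈F i)) , ≡.trans (index-cong (trans (sum-cong-≋ (λ i → *-congʳ (trans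
        (reflexive (≡.cong scalar (Finₚ.finToFun-funToFin _ i))) (scalar-digit (b∈F i))))) b·v≈x)) (index-element x)) }
    where
    span : Fin (suc (suc r) ℕ.^ n) → Fin q
    span e = index (linear (scalar ∘ finToFun {suc (suc r)} {n} e) v)

  independent : ∀ n → n ≤ suc R → ∃ λ (v : Fin n → Carrier) → Independent v
  independent zero    _   = (λ ()) , λ _ _ _ ()
  independent (suc n) n<R =
    let v , indep = independent n (ℕₚ.<⇒≤ n<R) in
    extend-independent v indep (≡.subst (suc (suc r) ℕ.^ n <_) (≡.sym q≡[2+r]^R) (ℕₚ.^-monoʳ-< (suc (suc r)) (s≤s (s≤s z≤n)) n<R))

  -- For m < n a relation over F among the rows of `H` kills every column, hence also `v`, although
  -- the coefficients `a` range over K.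
  independent-rank : ∀ {n m} (v : Fin n → Carrier) → Independent v → (H : Fin n → Fin m → Carrier) →
                     (∀ i j → Scalar (H i j)) → (a : Fin m → Carrier) → (∀ i → v i ≈ linear a (H i)) → n ≤ m
  independent-rank {n} {m} v indep H H∈F a v≈ = ℕₚ.≮⇒≥ λ m<n →
    let c , c∈F , (i , cᵢ≉0) , cH≈0 = kernel H H∈F m<n in
    cᵢ≉0 (indep c c∈F (begin
      linear c v
        ≈⟨ sum-cong-≋ (λ i → trans (*-congˡ (v≈ i)) (*-distribˡ-sum (c i) (λ j → a j * H i j))) ⟩
      sum (λ i → sum (λ j → c i * (a j * H i j)))
        ≈⟨ ∑-comm (λ i j → c i * (a j * H i j)) ⟩
      sum (λ j → sum (λ i → c i * (a j * H i j)))
        ≈⟨ sum-cong-≋ (λ j → trans (sum-cong-≋ (λ i → solve 3 (λ c a h → c :* (a :* h) := a :* (c :* h)) refl (c i) (a j) (H i j)))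
             (trans (sym (*-distribˡ-sum (a j) (λ i → c i * H i j))) (trans (*-congˡ (cH≈0 j)) (zeroʳ _)))) ⟩
      sum {m} (λ _ → 0#)
        ≈⟨ sum-replicate-zero m ⟩
      0# ∎) i)

-- If every value were attained, it would be attained away from `i`, because `j` can stand in for
-- `i`; this would embed `Fin (suc n)` into `Fin n`.
non-surjective : ∀ {n} (f : Fin n → Fin n) {i j} → i ≢ j → f i ≡ f j → ∃ λ x → ∀ k → f k ≢ x
non-surjective {suc n} f {i} {j} i≢j fi≡fj =
  let x , unreached = Finₚ.¬∀⟶∃¬ (suc n) (λ x → ∃ λ k → f k ≡ x) (λ x → Finₚ.any? (λ k → f k Fin.≟ x)) impossible in
  x , λ k fk≡x → unreached (k , fk≡x)
  where
  avoid : ∀ {x} → (∃ λ k → f k ≡ x) → ∃ λ k → i ≢ k × f k ≡ x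
  avoid (k , fk≡x) with i Fin.≟ k
  ... | yes ≡.refl = j , i≢j , ≡.trans (≡.sym fi≡fj) fk≡x
  ... | no  i≢k    = k , i≢k , fk≡x
  impossible : ¬ (∀ x → ∃ λ k → f k ≡ x)
  impossible surjective = ℕₚ.1+n≰n (Finₚ.injective⇒≤ {f = preimage} injective)
    where
    preimage : Fin (suc n) → Fin n
    preimage x = Fin.punchOut (proj₁ (proj₂ (avoid (surjective x))))
    injective : ∀ {x y} → preimage x ≡ preimage y → x ≡ y
    injective {x} {y} eq = ≡.trans (≡.sym (proj₂ (proj₂ (avoid (surjective x))))) (≡.trans
      (≡.cong f (Finₚ.punchOut-injective (proj₁ (proj₂ (avoid (surjective x)))) (proj₁ (proj₂ (avoid (surjective y)))) eq))
      (proj₂ (proj₂ (avoid (surjective y)))))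

-- Four skew lines in PG(3, q') without a common transversal

module CoreLines {c ℓ : Level} (K : CommutativeRing c ℓ) (isField : IsField K)
                (q : ℕ) (order : HasOrder K q)
                (p k R r : ℕ) (pr : Prime p) (pᵏ≡2+r : p ℕ.^ k ≡ suc (suc r))
                (q≡[2+r]^R : q ≡ suc (suc r) ℕ.^ suc R) where

  open CommutativeRing K hiding (zero)
  open IntegerSolver K
  open FieldProperties K isField q order
  open Subfield K isField q order p k R r pr pᵏ≡2+r q≡[2+r]^R
  open LinearAlgebra K isField q order p k R r pr pᵏ≡2+r q≡[2+r]^R
  open import Relation.Binary.Reasoning.Setoid setoid

  eval : ∀ {i} {I : Set i} {n} → (I → Fin n → Carrier) → List (I × Carrier) → Fin n → Carrier
  eval column []            row = 0#
  eval column ((i , a) ∷ L) row = a * column i row + eval column L row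

  Distinct : ∀ {I : Set} → List (I × Carrier) → Set c
  Distinct = AllPairs (λ t t′ → proj₁ t ≢ proj₁ t′)

  NonZeroCoefficients : ∀ {I : Set} → List (I × Carrier) → Set (c ⊔ ℓ)
  NonZeroCoefficients = All (λ t → proj₂ t ≉0)

  -- Terms form a list so that combinations can be filtered, permuted and appended. Length,
  -- distinctness and nonzero coefficients together are the exactness that the concatenation relies
  -- on.
  record Combination {I : Set} {n} (column : I → Fin n → Carrier) (s : Fin n → Carrier) (m : ℕ) : Set (c ⊔ ℓ) where
    constructor combination
    field
      terms    : List (I × Carrier)
      length≡  : length terms ≡ m
      distinct : Distinct terms
      nonzero  : NonZeroCoefficients terms
      value    : ∀ row → s row ≈ eval column terms row

  nonZeroTerm? : ∀ {I : Set} (t : I × Carrier) → Dec (proj₂ t ≉0)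
  nonZeroTerm? t = ¬? (proj₂ t ≟ 0#)

  eval-filter : ∀ {I : Set} {n} (column : I → Fin n → Carrier) L row →
                eval column L row ≈ eval column (filter nonZeroTerm? L) row
  eval-filter column []            row = refl
  eval-filter column ((i , a) ∷ L) row with a ≟ 0#
  ... | yes a≈0 = trans (+-congʳ (trans (*-congʳ a≈0) (zeroˡ _))) (trans (+-identityˡ _) (eval-filter column L row))
  ... | no  _   = +-congˡ (eval-filter column L row)

  -- Coefficients found by solving may vanish; dropping their terms leaves only an upper bound on
  -- the length.
  prune : ∀ {I : Set} {n} {column : I → Fin n → Carrier} {s} L → Distinct L → (∀ row → s row ≈ eval column L row) →
          ∃ λ m → m ≤ length L × Combination column s m
  prune {column = column} L distinct s≈ = length (filter nonZeroTerm? L) , Listₚ.length-filter nonZeroTerm? L ,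
    combination (filter nonZeroTerm? L) ≡.refl (AllPairsₚ.filter⁺ nonZeroTerm? distinct) (Allₚ.all-filter nonZeroTerm? L)
      (λ row → trans (s≈ row) (eval-filter column L row))

  x²+x : Carrier → Carrier
  x²+x x = x * x + x

  x²+x-∈F : ∀ {x} → Scalar x → Scalar (x²+x x)
  x²+x-∈F x∈F = +-∈F (*-∈F x∈F x∈F) x∈F

  -- x ↦ x² + x takes the value 0 at both 0 and -1, so it misses some value -b.
  irreducible : ∃ λ b → Scalar b × (∀ {x} → Scalar x → x²+x x + b ≉0)
  irreducible =
    let b , missed = non-surjective f {digit 0∈F} {digit -1∈F} 0≢-1 (same-digit 0∈F -1∈F
          (solve 1 (λ z → :0 :* :0 :+ :0 := (:- :1) :* (:- :1) :+ (:- :1)) refl 0#)) in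
    - scalar b , -‿∈F (scalar-Scalar b) , λ {x} x∈F eq → missed (digit x∈F) (scalar-injective {f (digit x∈F)} {b} (begin
      scalar (f (digit x∈F))       ≈⟨ scalar-digit (x²+x-∈F (scalar-Scalar (digit x∈F))) ⟩
      x²+x (scalar (digit x∈F))    ≈⟨ +-cong (*-cong (scalar-digit x∈F) (scalar-digit x∈F)) (scalar-digit x∈F) ⟩
      x²+x x                       ≈⟨ x-y≈0⇒x≈y eq ⟩
      scalar b                     ∎))
    where
    f : Fin (suc (suc r)) → Fin (suc (suc r))
    f i = digit (x²+x-∈F (scalar-Scalar i))
    -1∈F : Scalar (- 1#)
    -1∈F = -‿∈F 1∈F
    0≢-1 : digit 0∈F ≢ digit -1∈F
    0≢-1 eq = -‿≉0 1≉0 (trans (sym (scalar-digit -1∈F)) (trans (reflexive (≡.cong scalar (≡.sym eq))) (scalar-digit 0∈F)))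
    same-digit : ∀ {x y} (x∈F : Scalar x) (y∈F : Scalar y) → x²+x x ≈ x²+x y → f (digit x∈F) ≡ f (digit y∈F)
    same-digit {x} {y} x∈F y∈F eq = scalar-injective {f (digit x∈F)} {f (digit y∈F)} (begin
      scalar (f (digit x∈F))      ≈⟨ scalar-digit (x²+x-∈F (scalar-Scalar (digit x∈F))) ⟩
      x²+x (scalar (digit x∈F))   ≈⟨ +-cong (*-cong (scalar-digit x∈F) (scalar-digit x∈F)) (scalar-digit x∈F) ⟩
      x²+x x                      ≈⟨ eq ⟩
      x²+x y                      ≈⟨ +-cong (*-cong (scalar-digit y∈F) (scalar-digit y∈F)) (scalar-digit y∈F) ⟨
      x²+x (scalar (digit y∈F))   ≈⟨ scalar-digit (x²+x-∈F (scalar-Scalar (digit y∈F))) ⟨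
      scalar (f (digit y∈F))      ∎)

  abstract
    b : Carrier
    b = proj₁ irreducible

    b∈F : Scalar b
    b∈F = proj₁ (proj₂ irreducible)

    no-root : ∀ {x} → Scalar x → x²+x x + b ≉0
    no-root = proj₂ (proj₂ irreducible)

  -- Homogenisation of z² + z + b, the characteristic polynomial of (x, y) ↦ (-by, x - y), whose
  -- graph is the fourth line.
  form : Carrier → Carrier → Carrier
  form x y = b * (x * x) + x * y + y * y

  -- For x ≠ 0 and z = y/x the form equals x² (z² + z + b), and z² + z + b has no root in F; for x =
  -- 0 it is y².
  anisotropic : ∀ {x y} → Scalar x → Scalar y → x ≉0 ⊎ y ≉0 → form x y ≉0
  anisotropic {x} {y} x∈F y∈F x,y≉0 eq with x ≟ 0#
  ... | yes x≈0 = [ (λ x≉0 → x≉0 x≈0) , (λ y≉0 → *-≉0 y≉0 y≉0 (begin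
          y * y                          ≈⟨ solve 2 (λ b y → y :* y := b :* (:0 :* :0) :+ :0 :* y :+ y :* y) refl b y ⟩
          form 0# y                      ≈⟨ +-congʳ (+-cong (*-congˡ (*-cong x≈0 x≈0)) (*-congʳ x≈0)) ⟨
          form x y                       ≈⟨ eq ⟩
          0#                             ∎)) ]′ x,y≉0
  ... | no  x≉0 = no-root (*-∈F (recip-∈F x≉0 x∈F) y∈F) (*-cancel-≉0 (*-≉0 x≉0 x≉0) (begin
          x * x * (x²+x z + b)           ≈⟨ solve 3 (λ x z b → x :* x :* (z :* z :+ z :+ b) := b :* (x :* x) :+ x :* (x :* z) :+ (x :* z) :* (x :* z)) refl x z b ⟩
          form x (x * z)                 ≈⟨ +-cong (+-congˡ (*-congˡ xz)) (*-cong xz xz) ⟩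
          form x y                       ≈⟨ eq ⟩
          0#                             ∎))
    where
    z : Carrier
    z = recip x * y
    xz : x * z ≈ y
    xz = *-recip-cancelˡ y x≉0

  -- The q' + 1 points of PG(1, q'), normalised by `x₀` and `x₁` to (0 : 1) for `zero` and (1 : x)
  -- for a successor.
  Point : Set
  Point = Fin (suc (suc (suc r)))

  x₀ x₁ : Point → Carrier
  x₀ zero    = 0#
  x₀ (suc i) = 1#
  x₁ zero    = 1#
  x₁ (suc i) = scalar i

  -- The zero on PG(1, q') of the linear form (u, v). The inequality in `unique` says that (c, d) is
  -- not proportional to (u, v); `spans` concerns vectors over K. For the zero form a point is still
  -- chosen, whence the condition in `spans`.
  record Annihilated (u v : Carrier) : Set (c ⊔ ℓ) where
    field
      point     : Point
      vanishes  : u * x₀ point + v * x₁ point ≈ 0#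
      unique    : ∀ {c d} → c * v - d * u ≉0 → c * x₀ point + d * x₁ point ≉0
      spans     : u ≉0 ⊎ v ≉0 → ∀ {s t} → u * s + v * t ≈ 0# → ∃ λ a → s ≈ a * x₀ point × t ≈ a * x₁ point

  annihilated : ∀ {u v} → Scalar u → Scalar v → Annihilated u v
  annihilated {u} {v} u∈F v∈F with v ≟ 0#
  ... | yes v≈0 = record
    { point    = zero
    ; vanishes = trans (+-cong (zeroʳ u) (*-identityʳ v)) (trans (+-identityˡ v) v≈0)
    ; unique   = λ {c} {d} ne eq → ne (begin
        c * v - d * u     ≈⟨ +-cong (trans (*-congˡ v≈0) (zeroʳ c)) (-‿cong (*-congʳ (begin
          d                    ≈⟨ solve 2 (λ c d → d := c :* :0 :+ d :* :1) refl c d ⟩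
          c * 0# + d * 1#      ≈⟨ eq ⟩
          0#                   ∎))) ⟩
        0# - 0# * u       ≈⟨ solve 1 (λ u → :0 :- :0 :* u := :0) refl u ⟩
        0#                ∎)
    ; spans    = λ u,v≉0 {s} {t} eq → t , trans (*-cancel-≉0 ([ id , (λ v≉0 _ → v≉0 v≈0) ]′ u,v≉0) (begin
        u * s           ≈⟨ +-identityʳ _ ⟨
        u * s + 0#      ≈⟨ +-congˡ (trans (*-congʳ v≈0) (zeroˡ t)) ⟨
        u * s + v * t   ≈⟨ eq ⟩
        0#              ∎)) (sym (zeroʳ t)) , sym (*-identityʳ t)
    }
  ... | no v≉0 = record
    { point    = suc (digit y∈F)
    ; vanishes = begin
        u * 1# + v * scalar (digit y∈F)    ≈⟨ +-cong (*-identityʳ u) vy ⟩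
        u - u                              ≈⟨ -‿inverseʳ u ⟩
        0#                                 ∎
    ; unique   = λ {c} {d} ne eq → ne (begin
        c * v - d * u                               ≈⟨ solve 4 (λ c v d u → c :* v :- d :* u := c :* v :+ d :* (:- u)) refl c v d u ⟩
        c * v + d * (- u)                           ≈⟨ +-congˡ (*-congˡ vy) ⟨
        c * v + d * (v * scalar (digit y∈F))        ≈⟨ solve 4 (λ c d v y → c :* v :+ d :* (v :* y) := v :* (c :* :1 :+ d :* y)) refl c d v _ ⟩
        v * (c * 1# + d * scalar (digit y∈F))       ≈⟨ *-congˡ eq ⟩
        v * 0#                                      ≈⟨ zeroʳ v ⟩
        0#                                          ∎)
    ; spans    = λ _ {s} {t} eq → s , sym (*-identityʳ s) , *-injectiveˡ v≉0 (begin
        v * t                              ≈⟨ solve 3 (λ u s vt → vt := (u :* s :+ vt) :+ s :* (:- u)) refl u s (v * t) ⟩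
        (u * s + v * t) + s * (- u)        ≈⟨ +-cong eq (*-congˡ (sym vy)) ⟩
        0# + s * (v * scalar (digit y∈F))  ≈⟨ solve 3 (λ s v y → :0 :+ s :* (v :* y) := v :* (s :* y)) refl s v _ ⟩
        v * (s * scalar (digit y∈F))       ∎)
    }
    where
    y∈F : Scalar (- (recip v * u))
    y∈F = -‿∈F (*-∈F (recip-∈F v≉0 v∈F) u∈F)
    vy : v * scalar (digit y∈F) ≈ - u
    vy = begin
      v * scalar (digit y∈F)   ≈⟨ *-congˡ (scalar-digit y∈F) ⟩
      v * - (recip v * u)      ≈⟨ solve 3 (λ v w u → v :* (:- (w :* u)) := :- (v :* (w :* u))) refl v (recip v) u ⟩
      - (v * (recip v * u))    ≈⟨ -‿cong (*-recip-cancelˡ u v≉0) ⟩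
      - u                      ∎

  -- The fourth line is the graph of a linear map without eigenvectors over the subfield, so it
  -- misses every transversal of the first three.
  place : Fin 4 → Carrier → Carrier → Fin 4 → Carrier
  place 0F x y 0F = x
  place 0F x y 1F = y
  place 0F x y 2F = 0#
  place 0F x y 3F = 0#
  place 1F x y 0F = 0#
  place 1F x y 1F = 0#
  place 1F x y 2F = x
  place 1F x y 3F = y
  place 2F x y 0F = x
  place 2F x y 1F = y
  place 2F x y 2F = x
  place 2F x y 3F = y
  place 3F x y 0F = x
  place 3F x y 1F = y
  place 3F x y 2F = - (b * y)
  place 3F x y 3F = x - y

  linePoint : Fin 4 × Point → Fin 4 → Carrier
  linePoint (i , P) = place i (x₀ P) (x₁ P)

  dot : (Fin 4 → Carrier) → (Fin 4 → Carrier) → Carrier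
  dot c s = c 0F * s 0F + c 1F * s 1F + (c 2F * s 2F + c 3F * s 3F)

  CoreCombination : (Fin 4 → Carrier) → Set (c ⊔ ℓ)
  CoreCombination s = ∃ λ m → m ≤ 3 × Combination linePoint s m

  zero-or-not : ∀ x y → (x ≈ 0# × y ≈ 0#) ⊎ (x ≉0 ⊎ y ≉0)
  zero-or-not x y with x ≟ 0# | y ≟ 0#
  ... | no x≉0  | _       = inj₂ (inj₁ x≉0)
  ... | yes _   | no y≉0  = inj₂ (inj₂ y≉0)
  ... | yes x≈0 | yes y≈0 = inj₁ (x≈0 , y≈0)

  module _ (c : Fin 4 → Carrier) (c∈F : ∀ i → Scalar (c i)) (s : Fin 4 → Carrier) (c·s≈0 : dot c s ≈ 0#) where

    -- Here the plane contains the first line: two points of it, together with the plane's point on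
    -- the second line, suffice.
    combine-lower : c 0F ≈ 0# → c 1F ≈ 0# → c 2F ≉0 ⊎ c 3F ≉0 → CoreCombination s
    combine-lower c₀≈0 c₁≈0 c₂,c₃≉0 =
      let a , s₂ , s₃ = spans c₂,c₃≉0 (begin
            c 2F * s 2F + c 3F * s 3F                           ≈⟨ solve 3 (λ s t u → u := :0 :* s :+ :0 :* t :+ u) refl (s 0F) (s 1F) _ ⟩
            0# * s 0F + 0# * s 1F + (c 2F * s 2F + c 3F * s 3F) ≈⟨ +-congʳ (+-cong (*-congʳ c₀≈0) (*-congʳ c₁≈0)) ⟨
            dot c s                                             ≈⟨ c·s≈0 ⟩
            0#                                                  ∎) in
      prune (((0F , 1F) , s 0F) ∷ ((0F , 0F) , s 1F) ∷ ((1F , point) , a) ∷ [])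
        (((λ ()) ∷ (λ ()) ∷ []) ∷ ((λ ()) ∷ []) ∷ [] ∷ [])
        λ { 0F → solve 3 (λ s t a → s := s :* :1 :+ (t :* :0 :+ (a :* :0 :+ :0))) refl (s 0F) (s 1F) a
          ; 1F → solve 3 (λ s t a → t := s :* :0 :+ (t :* :1 :+ (a :* :0 :+ :0))) refl (s 0F) (s 1F) a
          ; 2F → trans s₂ (solve 3 (λ s t u → u := s :* :0 :+ (t :* :0 :+ (u :+ :0))) refl (s 0F) (s 1F) _)
          ; 3F → trans s₃ (solve 3 (λ s t u → u := s :* :0 :+ (t :* :0 :+ (u :+ :0))) refl (s 0F) (s 1F) _)
          }
      where open Annihilated (annihilated (c∈F 2F) (c∈F 3F))

    combine-upper : c 2F ≈ 0# → c 3F ≈ 0# → c 0F ≉0 ⊎ c 1F ≉0 → CoreCombination s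
    combine-upper c₂≈0 c₃≈0 c₀,c₁≉0 =
      let a , s₀ , s₁ = spans c₀,c₁≉0 (begin
            c 0F * s 0F + c 1F * s 1F                           ≈⟨ solve 3 (λ s t u → u := u :+ (:0 :* s :+ :0 :* t)) refl (s 2F) (s 3F) _ ⟩
            c 0F * s 0F + c 1F * s 1F + (0# * s 2F + 0# * s 3F) ≈⟨ +-congˡ (+-cong (*-congʳ c₂≈0) (*-congʳ c₃≈0)) ⟨
            dot c s                                             ≈⟨ c·s≈0 ⟩
            0#                                                  ∎) in
      prune (((0F , point) , a) ∷ ((1F , 1F) , s 2F) ∷ ((1F , 0F) , s 3F) ∷ [])
        (((λ ()) ∷ (λ ()) ∷ []) ∷ ((λ ()) ∷ []) ∷ [] ∷ [])
        λ { 0F → trans s₀ (solve 3 (λ s t u → u := u :+ (s :* :0 :+ (t :* :0 :+ :0))) refl (s 2F) (s 3F) _)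
          ; 1F → trans s₁ (solve 3 (λ s t u → u := u :+ (s :* :0 :+ (t :* :0 :+ :0))) refl (s 2F) (s 3F) _)
          ; 2F → solve 3 (λ s t a → s := a :* :0 :+ (s :* :1 :+ (t :* :0 :+ :0))) refl (s 2F) (s 3F) a
          ; 3F → solve 3 (λ s t a → t := a :* :0 :+ (s :* :0 :+ (t :* :1 :+ :0))) refl (s 2F) (s 3F) a
          }
      where open Annihilated (annihilated (c∈F 0F) (c∈F 1F))

    -- Subtracting a suitable multiple of a point of the third or fourth line leaves a
    -- vector both of whose halves are annihilated by the corresponding half of c.
    combine-transversal : c 0F ≉0 ⊎ c 1F ≉0 → c 2F ≉0 ⊎ c 3F ≉0 → ∀ i P → 0F ≢ i → 1F ≢ i →
                          dot c (linePoint (i , P)) ≈ 0# →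
                          c 0F * linePoint (i , P) 0F + c 1F * linePoint (i , P) 1F ≉0 → CoreCombination s
    combine-transversal c₀,c₁≉0 c₂,c₃≉0 i P 0≢i 1≢i c·P≈0 half≉0 =
      let a₀ , s₀ , s₁ = U.spans c₀,c₁≉0 upper≈0
          a₁ , s₂ , s₃ = L.spans c₂,c₃≉0 lower≈0 in
      prune (((0F , U.point) , a₀) ∷ ((1F , L.point) , a₁) ∷ ((i , P) , a) ∷ [])
        (((λ ()) ∷ (0≢i ∘ ≡.cong proj₁) ∷ []) ∷ ((1≢i ∘ ≡.cong proj₁) ∷ []) ∷ [] ∷ [])
        λ { 0F → upper s₀ ; 1F → upper s₁ ; 2F → lower s₂ ; 3F → lower s₃ }
      where
      module U = Annihilated (annihilated (c∈F 0F) (c∈F 1F))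
      module L = Annihilated (annihilated (c∈F 2F) (c∈F 3F))
      v : Fin 4 → Carrier
      v = linePoint (i , P)
      e h a : Carrier
      e = c 0F * v 0F + c 1F * v 1F
      h = c 0F * s 0F + c 1F * s 1F
      -- This choice makes the upper half of `c` kill s - a v. The lower half then does so too,
      -- since `c` kills both `s` and `v`.
      a = recip e * h
      ea≈h : e * a ≈ h
      ea≈h = *-recip-cancelˡ h half≉0
      upper≈0 : c 0F * (s 0F - a * v 0F) + c 1F * (s 1F - a * v 1F) ≈ 0#
      upper≈0 = trans (solve 7 (λ c d s t v w a → c :* (s :- a :* v) :+ d :* (t :- a :* w)
                        := (c :* s :+ d :* t) :- (c :* v :+ d :* w) :* a)
                        refl (c 0F) (c 1F) (s 0F) (s 1F) (v 0F) (v 1F) a) (x≈y⇒x-y≈0 (sym ea≈h))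
      lower≈0 : c 2F * (s 2F - a * v 2F) + c 3F * (s 3F - a * v 3F) ≈ 0#
      lower≈0 = begin
        c 2F * (s 2F - a * v 2F) + c 3F * (s 3F - a * v 3F)
          ≈⟨ solve 9 (λ c d s t v w a h e → c :* (s :- a :* v) :+ d :* (t :- a :* w)
               := ((h :+ (c :* s :+ d :* t)) :- (e :+ (c :* v :+ d :* w)) :* a) :- (h :- e :* a))
               refl (c 2F) (c 3F) (s 2F) (s 3F) (v 2F) (v 3F) a h e ⟩
        dot c s - dot c v * a - (h - e * a)
          ≈⟨ +-cong (+-cong c·s≈0 (-‿cong (*-congʳ c·P≈0))) (-‿cong (x≈y⇒x-y≈0 (sym ea≈h))) ⟩
        0# - 0# * a - 0#
          ≈⟨ solve 1 (λ a → :0 :- :0 :* a :- :0 := :0) refl a ⟩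
        0# ∎
      upper : ∀ {x y z a₁} → x - a * y ≈ z → x ≈ z + (a₁ * 0# + (a * y + 0#))
      upper {x} {y} {z} {a₁} eq = trans (solve 3 (λ x ay a₁ → x := (x :- ay) :+ (a₁ :* :0 :+ (ay :+ :0))) refl x (a * y) a₁) (+-congʳ eq)
      lower : ∀ {x y z a₀} → x - a * y ≈ z → x ≈ a₀ * 0# + (z + (a * y + 0#))
      lower {x} {y} {z} {a₀} eq = trans (solve 3 (λ x ay a₀ → x := a₀ :* :0 :+ ((x :- ay) :+ (ay :+ :0))) refl x (a * y) a₀) (+-congˡ (+-congʳ eq))

    -- Vanishes exactly when the halves of `c` are proportional. Otherwise the plane's point on the
    -- third line is off the join of its points on the first two.
    determinant : Carrier
    determinant = c 0F * c 3F - c 1F * c 2F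

    combine-third : c 0F ≉0 ⊎ c 1F ≉0 → c 2F ≉0 ⊎ c 3F ≉0 → determinant ≉0 → CoreCombination s
    combine-third c₀,c₁≉0 c₂,c₃≉0 det≉0 = combine-transversal c₀,c₁≉0 c₂,c₃≉0 2F point (λ ()) (λ ())
      (trans (solve 6 (λ c₀ c₁ c₂ c₃ x y → c₀ :* x :+ c₁ :* y :+ (c₂ :* x :+ c₃ :* y) := (c₀ :+ c₂) :* x :+ (c₁ :+ c₃) :* y)
        refl (c 0F) (c 1F) (c 2F) (c 3F) (x₀ point) (x₁ point)) vanishes)
      (unique λ eq → det≉0 (trans (solve 4 (λ c₀ c₁ c₂ c₃ → c₀ :* c₃ :- c₁ :* c₂ := c₀ :* (c₁ :+ c₃) :- c₁ :* (c₀ :+ c₂))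
        refl (c 0F) (c 1F) (c 2F) (c 3F)) eq))
      where open Annihilated (annihilated (+-∈F (c∈F 0F) (c∈F 2F)) (+-∈F (c∈F 1F) (c∈F 3F)))

    -- If the plane's point on the fourth line were on that join as well, the two polynomial
    -- identities below would make c₂ and c₃ times `form` at (c₀, c₁) vanish, against anisotropy.
    combine-fourth : c 0F ≉0 ⊎ c 1F ≉0 → c 2F ≉0 ⊎ c 3F ≉0 → determinant ≈ 0# → CoreCombination s
    combine-fourth c₀,c₁≉0 c₂,c₃≉0 det≈0 = combine-transversal c₀,c₁≉0 c₂,c₃≉0 3F point (λ ()) (λ ())
      (trans (solve 7 (λ c₀ c₁ c₂ c₃ b x y → c₀ :* x :+ c₁ :* y :+ (c₂ :* (:- (b :* y)) :+ c₃ :* (x :- y))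
          := (c₀ :+ c₃) :* x :+ (c₁ :- (b :* c₂ :+ c₃)) :* y)
        refl (c 0F) (c 1F) (c 2F) (c 3F) b (x₀ point) (x₁ point)) vanishes)
      (unique λ eq → [ (λ c₂≉0 → *-≉0 c₂≉0 form≉0 (begin
            c 2F * form (c 0F) (c 1F)
              ≈⟨ solve 5 (λ c₀ c₁ c₂ c₃ b → c₂ :* (b :* (c₀ :* c₀) :+ c₀ :* c₁ :+ c₁ :* c₁)
                   := (:- c₀) :* (c₀ :* (c₁ :- (b :* c₂ :+ c₃)) :- c₁ :* (c₀ :+ c₃)) :- (c₀ :+ c₁) :* (c₀ :* c₃ :- c₁ :* c₂))
                   refl (c 0F) (c 1F) (c 2F) (c 3F) b ⟩
            - c 0F * (c 0F * (c 1F - (b * c 2F + c 3F)) - c 1F * (c 0F + c 3F)) - (c 0F + c 1F) * determinant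
              ≈⟨ vanish eq ⟩
            0# ∎))
          , (λ c₃≉0 → *-≉0 c₃≉0 form≉0 (begin
            c 3F * form (c 0F) (c 1F)
              ≈⟨ solve 5 (λ c₀ c₁ c₂ c₃ b → c₃ :* (b :* (c₀ :* c₀) :+ c₀ :* c₁ :+ c₁ :* c₁)
                   := (:- c₁) :* (c₀ :* (c₁ :- (b :* c₂ :+ c₃)) :- c₁ :* (c₀ :+ c₃)) :- (:- (b :* c₀)) :* (c₀ :* c₃ :- c₁ :* c₂))
                   refl (c 0F) (c 1F) (c 2F) (c 3F) b ⟩
            - c 1F * (c 0F * (c 1F - (b * c 2F + c 3F)) - c 1F * (c 0F + c 3F)) - (- (b * c 0F)) * determinant
              ≈⟨ vanish eq ⟩
            0# ∎)) ]′ c₂,c₃≉0)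
      where
      open Annihilated (annihilated (+-∈F (c∈F 0F) (c∈F 3F)) (+-∈F (c∈F 1F) (-‿∈F (+-∈F (*-∈F b∈F (c∈F 2F)) (c∈F 3F)))))
      form≉0 : form (c 0F) (c 1F) ≉0
      form≉0 = anisotropic (c∈F 0F) (c∈F 1F) c₀,c₁≉0
      vanish : ∀ {x y z} → x ≈ 0# → y * x - z * determinant ≈ 0#
      vanish {x} {y} {z} x≈0 = trans (+-cong (*-congˡ x≈0) (-‿cong (*-congˡ det≈0)))
        (solve 2 (λ y z → y :* :0 :- z :* :0 := :0) refl y z)

    core-combination : NonZeroVector c → CoreCombination s
    core-combination (i , cᵢ≉0) with zero-or-not (c 0F) (c 1F) | zero-or-not (c 2F) (c 3F)
    ... | inj₁ (c₀≈0 , c₁≈0) | inj₂ c₂,c₃≉0 = combine-lower c₀≈0 c₁≈0 c₂,c₃≉0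
    ... | inj₂ c₀,c₁≉0 | inj₁ (c₂≈0 , c₃≈0) = combine-upper c₂≈0 c₃≈0 c₀,c₁≉0
    ... | inj₁ (c₀≈0 , c₁≈0) | inj₁ (c₂≈0 , c₃≈0) = ⊥-elim (cᵢ≉0 (all≈0 i))
      where
      all≈0 : ∀ i → c i ≈ 0#
      all≈0 0F = c₀≈0
      all≈0 1F = c₁≈0
      all≈0 2F = c₂≈0
      all≈0 3F = c₃≈0
    ... | inj₂ c₀,c₁≉0 | inj₂ c₂,c₃≉0 with determinant ≟ 0#
    ...   | no  det≉0 = combine-third c₀,c₁≉0 c₂,c₃≉0 det≉0
    ...   | yes det≈0 = combine-fourth c₀,c₁≉0 c₂,c₃≉0 det≈0

-- The point set in PG(R, q'), with q' = r + 3 from here on, and exact combinations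

module BaseCode {c ℓ : Level} (K : CommutativeRing c ℓ) (isField : IsField K)
                (q : ℕ) (order : HasOrder K q)
                (p k R r : ℕ) (pr : Prime p) (pᵏ≡3+r : p ℕ.^ k ≡ suc (suc (suc r)))
                (q≡[3+r]^R : q ≡ suc (suc (suc r)) ℕ.^ suc R) where

  open CommutativeRing K hiding (zero)
  open IntegerSolver K
  open FieldProperties K isField q order
  open Subfield K isField q order p k R (suc r) pr pᵏ≡3+r q≡[3+r]^R
  open LinearAlgebra K isField q order p k R (suc r) pr pᵏ≡3+r q≡[3+r]^R
  open CoreLines K isField q order p k R (suc r) pr pᵏ≡3+r q≡[3+r]^R
  open import Relation.Binary.Reasoning.Setoid setoid

  δ : ∀ {n} → Fin n → Fin n → Carrier
  δ zero    zero    = 1#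
  δ zero    (suc j) = 0#
  δ (suc i) zero    = 0#
  δ (suc i) (suc j) = δ i j

  δ-diagonal : ∀ {n} (i : Fin n) → δ i i ≈ 1#
  δ-diagonal zero    = refl
  δ-diagonal (suc i) = δ-diagonal i

  δ-off-diagonal : ∀ {n} {i j : Fin n} → i ≢ j → δ i j ≈ 0#
  δ-off-diagonal {i = zero}  {zero}  i≢j = ⊥-elim (i≢j ≡.refl)
  δ-off-diagonal {i = zero}  {suc j} i≢j = refl
  δ-off-diagonal {i = suc i} {zero}  i≢j = refl
  δ-off-diagonal {i = suc i} {suc j} i≢j = δ-off-diagonal (i≢j ∘ ≡.cong suc)

  Digit : Set
  Digit = Fin (suc (suc (suc r)))

  Spoke : ℕ → Set
  Spoke n = Maybe (Fin n × Fin (suc (suc r)))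

  -- Besides the base point e₀ (nothing), the points e_j + x e₀ with x ≠ 0 in the subfield.
  spokeColumn : ∀ {n} → Spoke n → Fin (suc n) → Carrier
  spokeColumn nothing        zero    = 1#
  spokeColumn nothing        (suc i) = 0#
  spokeColumn (just (j , u)) zero    = unit u
  spokeColumn (just (j , u)) (suc i) = δ j i

  Index : ℕ → Set
  Index zero    = Fin 4 × Point
  Index (suc M) = Index M ⊎ Spoke (4 ℕ.+ M)

  -- The new coordinate is put in front, so that the four lines of the core live in the last four coordinates.
  column : ∀ M → Index M → Fin (4 ℕ.+ M) → Carrier
  column zero    i        row       = linePoint i row
  column (suc M) (inj₁ i) zero      = 0#
  column (suc M) (inj₁ i) (suc row) = column M i row
  column (suc M) (inj₂ t) row       = spokeColumn t row

  -- In the core the first two lines pass through the four vertices; on each, `1F` is (1 : 0) and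
  -- `0F` is (0 : 1).
  vertex : ∀ M → Fin (4 ℕ.+ M) → Index M
  vertex zero    0F      = 0F , 1F
  vertex zero    1F      = 0F , 0F
  vertex zero    2F      = 1F , 1F
  vertex zero    3F      = 1F , 0F
  vertex (suc M) zero    = inj₂ nothing
  vertex (suc M) (suc j) = inj₁ (vertex M j)

  column-vertex : ∀ M j row → column M (vertex M j) row ≈ δ j row
  column-vertex zero 0F 0F = refl
  column-vertex zero 0F 1F = refl
  column-vertex zero 0F 2F = refl
  column-vertex zero 0F 3F = refl
  column-vertex zero 1F 0F = refl
  column-vertex zero 1F 1F = refl
  column-vertex zero 1F 2F = refl
  column-vertex zero 1F 3F = refl
  column-vertex zero 2F 0F = refl
  column-vertex zero 2F 1F = refl
  column-vertex zero 2F 2F = refl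
  column-vertex zero 2F 3F = refl
  column-vertex zero 3F 0F = refl
  column-vertex zero 3F 1F = refl
  column-vertex zero 3F 2F = refl
  column-vertex zero 3F 3F = refl
  column-vertex (suc M) zero    zero      = refl
  column-vertex (suc M) zero    (suc row) = refl
  column-vertex (suc M) (suc j) zero      = refl
  column-vertex (suc M) (suc j) (suc row) = column-vertex M j row

  vertex-injective : ∀ M {i j} → vertex M i ≡ vertex M j → i ≡ j
  vertex-injective M {i} {j} eq with i Fin.≟ j
  ... | yes i≡j = i≡j
  ... | no  i≢j = ⊥-elim (0≉1′ (begin
    0#                         ≈⟨ δ-off-diagonal i≢j ⟨
    δ i j                      ≈⟨ column-vertex M i j ⟨
    column M (vertex M i) j    ≡⟨ ≡.cong (λ t → column M t j) eq ⟩
    column M (vertex M j) j    ≈⟨ column-vertex M j j ⟩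
    δ j j                      ≈⟨ δ-diagonal j ⟩
    1#                         ∎))
    where
    0≉1′ : ¬ (0# ≈ 1#)
    0≉1′ eq = 1≉0 (sym eq)

  -- The lower bound on the covering radius rests on this, because `independent-rank` needs entries
  -- in F.
  column-∈F : ∀ M i row → Scalar (column M i row)
  column-∈F zero (i , P) row = place-∈F i row (x₀-∈F P) (x₁-∈F P)
    where
    x₀-∈F : ∀ P → Scalar (x₀ P)
    x₀-∈F zero    = 0∈F
    x₀-∈F (suc _) = 1∈F
    x₁-∈F : ∀ P → Scalar (x₁ P)
    x₁-∈F zero    = 1∈F
    x₁-∈F (suc i) = scalar-Scalar i
    place-∈F : ∀ i row {x y} → Scalar x → Scalar y → Scalar (place i x y row)
    place-∈F 0F 0F x∈F y∈F = x∈F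
    place-∈F 0F 1F x∈F y∈F = y∈F
    place-∈F 0F 2F x∈F y∈F = 0∈F
    place-∈F 0F 3F x∈F y∈F = 0∈F
    place-∈F 1F 0F x∈F y∈F = 0∈F
    place-∈F 1F 1F x∈F y∈F = 0∈F
    place-∈F 1F 2F x∈F y∈F = x∈F
    place-∈F 1F 3F x∈F y∈F = y∈F
    place-∈F 2F 0F x∈F y∈F = x∈F
    place-∈F 2F 1F x∈F y∈F = y∈F
    place-∈F 2F 2F x∈F y∈F = x∈F
    place-∈F 2F 3F x∈F y∈F = y∈F
    place-∈F 3F 0F x∈F y∈F = x∈F
    place-∈F 3F 1F x∈F y∈F = y∈F
    place-∈F 3F 2F x∈F y∈F = -‿∈F (*-∈F b∈F y∈F)
    place-∈F 3F 3F x∈F y∈F = +-∈F x∈F (-‿∈F y∈F)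
  column-∈F (suc M) (inj₁ i)              zero      = 0∈F
  column-∈F (suc M) (inj₁ i)              (suc row) = column-∈F M i row
  column-∈F (suc M) (inj₂ nothing)        zero      = 1∈F
  column-∈F (suc M) (inj₂ nothing)        (suc row) = 0∈F
  column-∈F (suc M) (inj₂ (just (j , u))) zero      = scalar-Scalar (suc u)
  column-∈F (suc M) (inj₂ (just (j , u))) (suc row) = δ-∈F j row
    where
    δ-∈F : ∀ {n} (i j : Fin n) → Scalar (δ i j)
    δ-∈F zero    zero    = 1∈F
    δ-∈F zero    (suc j) = 0∈F
    δ-∈F (suc i) zero    = 0∈F
    δ-∈F (suc i) (suc j) = δ-∈F i j

  eval-++ : ∀ {I : Set} {n} (col : I → Fin n → Carrier) L L′ row →
            eval col (L ++ L′) row ≈ eval col L row + eval col L′ row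
  eval-++ col []            L′ row = sym (+-identityˡ _)
  eval-++ col ((i , a) ∷ L) L′ row = trans (+-congˡ (eval-++ col L L′ row)) (sym (+-assoc _ _ _))

  eval-map : ∀ {I J : Set} {n} (f : I → J) (col : J → Fin n → Carrier) L row →
             eval col (map (map₁ f) L) row ≈ eval (col ∘ f) L row
  eval-map f col []            row = refl
  eval-map f col ((i , a) ∷ L) row = +-congˡ (eval-map f col L row)

  eval-lower-zero : ∀ M L → eval (column (suc M) ∘ inj₁) L zero ≈ 0#
  eval-lower-zero M []            = refl
  eval-lower-zero M ((i , a) ∷ L) = trans (+-cong (zeroʳ a) (eval-lower-zero M L)) (+-identityˡ _)

  eval-lower-suc : ∀ M L row → eval (column (suc M) ∘ inj₁) L (suc row) ≈ eval (column M) L row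
  eval-lower-suc M []            row = refl
  eval-lower-suc M ((i , a) ∷ L) row = +-congˡ (eval-lower-suc M L row)

  eval-↭ : ∀ {I : Set} {n} (col : I → Fin n → Carrier) {L L′} → L ↭ L′ → ∀ row → eval col L row ≈ eval col L′ row
  eval-↭ col ↭.refl              row = refl
  eval-↭ col (↭.prep t L↭L′)     row = +-congˡ (eval-↭ col L↭L′ row)
  eval-↭ col (↭.swap t t′ L↭L′)  row = trans (+-congˡ (+-congˡ (eval-↭ col L↭L′ row)))
    (solve 3 (λ x y z → x :+ (y :+ z) := y :+ (x :+ z)) refl _ _ _)
  eval-↭ col (↭.trans L↭L′ L′↭L″) row = trans (eval-↭ col L↭L′ row) (eval-↭ col L′↭L″ row)

  eval-tabulate : ∀ {I : Set} {n m} (col : I → Fin n → Carrier) (f : Fin m → I × Carrier) row →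
                  eval col (tabulate f) row ≈ sum (λ j → proj₂ (f j) * col (proj₁ (f j)) row)
  eval-tabulate {m = zero}  col f row = refl
  eval-tabulate {m = suc m} col f row = +-congˡ (eval-tabulate col (f ∘ suc) row)

  eval-zeros : ∀ {I : Set} {n} (col : I → Fin n → Carrier) L row → All (λ t → proj₂ t ≈ 0#) L → eval col L row ≈ 0#
  eval-zeros col []            row []          = refl
  eval-zeros col ((i , a) ∷ L) row (a≈0 ∷ as) = trans (+-cong (trans (*-congʳ a≈0) (zeroˡ _)) (eval-zeros col L row as)) (+-identityˡ 0#)

  data OnLines {n} (zs : List (Fin n)) : Spoke n → Set where
    base  : OnLines zs nothing
    spoke : ∀ {j u} → j ∈ zs → OnLines zs (just (j , u))

  baseMultiple : ∀ {n} → Carrier → Fin (suc n) → Carrier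
  baseMultiple a zero    = a
  baseMultiple a (suc _) = 0#

  -- A device for padding: a multiple of e₀ is spread over as many points as there are edges in
  -- `zs`, so that a combination reaches full length. `onLines` keeps these points apart from those
  -- on other edges.
  record Fan {n} (zs : List (Fin n)) (a : Carrier) : Set (c ⊔ ℓ) where
    field
      represent : Combination spokeColumn (baseMultiple a) (length zs)
    open Combination represent public
    field
      onLines : All (OnLines zs ∘ proj₁) terms

  gap : Carrier
  gap = unit 0F - unit 1F

  gap≉0 : gap ≉0
  gap≉0 = ≉⇒-≉0 (λ eq → Finₚ.0≢1+n (unit-injective {0F} {1F} eq))

  fan-[] : ∀ {n a} → a ≈ 0# → Fan {n} [] a
  fan-[] a≈0 = record
    { represent = combination [] ≡.refl [] [] λ { zero → a≈0 ; (suc _) → refl }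
    ; onLines   = []
    }

  fan-singleton : ∀ {n a} (z : Fin n) → a ≉0 → Fan (z ∷ []) a
  fan-singleton {a = a} z a≉0 = record
    { represent = combination ((nothing , a) ∷ []) ≡.refl ([] ∷ []) (a≉0 ∷ [])
        λ { zero    → solve 1 (λ a → a := a :* :1 :+ :0) refl a
          ; (suc _) → solve 1 (λ a → :0 := a :* :0 :+ :0) refl a }
    ; onLines   = base ∷ []
    }

  -- Two points on the edge of `z` differ by `gap` times e₀, which accounts for b e₀. The edge of
  -- `z′` only pays for the second term and stays empty.
  fan-pair : ∀ {n a b} (z z′ : Fin n) {zs} → All (z ≢_) zs → b ≉0 → Fan zs (a - b) → Fan (z ∷ z′ ∷ zs) a
  fan-pair {n} {a} {b} z z′ {zs} z∉zs b≉0 fan = record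
    { represent = combination ((just (z , 0F) , d) ∷ (just (z , 1F) , - d) ∷ terms) (≡.cong (λ n → suc (suc n)) length≡)
        (((λ ()) ∷ All.map fresh onLines) ∷ All.map fresh onLines ∷ distinct) (d≉0 ∷ -‿≉0 d≉0 ∷ nonzero) value′
    ; onLines   = spoke (here ≡.refl) ∷ spoke (here ≡.refl) ∷ All.map weaken onLines
    }
    where
    open Fan fan
    d : Carrier
    d = recip gap * b
    d≉0 : d ≉0
    d≉0 = *-≉0 (recip-≉0 gap≉0) b≉0
    fresh : ∀ {u} {t : Spoke n} → OnLines zs t → just (z , u) ≢ t
    fresh (spoke j∈zs) ≡.refl = All.lookup z∉zs j∈zs ≡.refl
    weaken : ∀ {t : Spoke n} → OnLines zs t → OnLines (z ∷ z′ ∷ zs) t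
    weaken base         = base
    weaken (spoke j∈zs) = spoke (there (there j∈zs))
    value′ : ∀ row → baseMultiple a row ≈ d * spokeColumn (just (z , 0F)) row + (- d * spokeColumn (just (z , 1F)) row + eval spokeColumn terms row)
    value′ zero = begin
      a                                              ≈⟨ solve 2 (λ a b → a := b :+ (a :- b)) refl a b ⟩
      b + (a - b)                                    ≈⟨ +-cong (sym (*-recip-cancelˡ b gap≉0)) (value zero) ⟩
      gap * d + eval spokeColumn terms zero          ≈⟨ solve 4 (λ u v d e → (u :- v) :* d :+ e := d :* u :+ ((:- d) :* v :+ e)) refl (unit 0F) (unit 1F) d _ ⟩
      d * unit 0F + (- d * unit 1F + eval spokeColumn terms zero) ∎
    value′ (suc row) = trans (value (suc row)) (solve 3 (λ d x e → e := d :* x :+ ((:- d) :* x :+ e)) refl d (δ z row) _)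

  -- At most one of two distinct nonzero scalars equals `a`; the remainder a - b must not vanish for
  -- the fan to continue.
  avoid-two : ∀ a → ∃ λ b → b ≉0 × a - b ≉0
  avoid-two a with a ≟ unit 0F
  ... | no  a≉u = unit 0F , unit-≉0 0F , ≉⇒-≉0 a≉u
  ... | yes a≈u = unit 1F , unit-≉0 1F , λ eq → gap≉0 (trans (+-congʳ (sym a≈u)) eq)

  -- Pairs are split off until an odd number of edges ends with the point e₀ itself, or an even
  -- number with a pair that takes the whole remainder.
  fan-≉0 : ∀ {n a} (z : Fin n) zs → Unique (z ∷ zs) → a ≉0 → Fan (z ∷ zs) a
  fan-≉0 z []            u a≉0 = fan-singleton z a≉0
  fan-≉0 z (z′ ∷ [])     u a≉0 = fan-pair z z′ [] a≉0 (fan-[] (-‿inverseʳ _))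
  fan-≉0 {a = a} z (z′ ∷ z″ ∷ zs) ((_ ∷ z∉) ∷ _ ∷ u) a≉0 =
    let b , b≉0 , a-b≉0 = avoid-two a in fan-pair z z′ z∉ b≉0 (fan-≉0 z″ zs u a-b≉0)

  -- The first pair contributes 1, leaving the nonzero target -1 for the remaining edges, of which
  -- there is at least one.
  fan-≈0 : ∀ {n} zs → Unique {A = Fin n} zs → 3 ≤ length zs → Fan zs 0#
  fan-≈0 (z ∷ z′ ∷ z″ ∷ zs) ((_ ∷ z∉) ∷ _ ∷ u) 3≤ = fan-pair z z′ z∉ 1≉0
    (fan-≉0 z″ zs u (λ eq → -‿≉0 1≉0 (trans (sym (+-identityˡ _)) eq)))
  fan-≈0 (_ ∷ [])     _ (s≤s ())
  fan-≈0 (_ ∷ _ ∷ []) _ (s≤s (s≤s ()))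

  -- All points except e₀ of the edge joining e₀ to e_j; the digit 0 gives the vertex e_j, which is
  -- already an older point.
  affine : ∀ M → Fin (4 ℕ.+ M) → Digit → Index (suc M)
  affine M j zero    = inj₁ (vertex M j)
  affine M j (suc u) = inj₂ (just (j , u))

  affine-injective : ∀ M {i j x y} → affine M i x ≡ affine M j y → i ≡ j
  affine-injective M {x = zero}  {zero}  eq     = vertex-injective M (Sumₚ.inj₁-injective eq)
  affine-injective M {x = suc _} {suc _} ≡.refl = ≡.refl

  affine-zero : ∀ M j x → column (suc M) (affine M j x) zero ≈ scalar x
  affine-zero M j zero    = refl
  affine-zero M j (suc u) = refl

  affine-suc : ∀ M j x row → column (suc M) (affine M j x) (suc row) ≈ δ j row
  affine-suc M j zero    row = column-vertex M j row
  affine-suc M j (suc u) row = refl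

  affine∉fan : ∀ M {j x zs t} → OnLines zs t → All (j ≢_) zs → affine M j x ≢ inj₂ t
  affine∉fan M {x = suc u} (spoke j∈zs) j∉zs ≡.refl = All.lookup j∉zs j∈zs ≡.refl

  sum-δ : ∀ {n} (s : Fin n → Carrier) i → s i ≈ sum (λ j → s j * δ j i)
  sum-δ s i = sym (trans
    (sum-single +-commutativeMonoid (λ j → s j * δ j i) i (λ j j≢i → trans (*-congˡ (δ-off-diagonal j≢i)) (zeroʳ _)))
    (trans (*-congˡ (δ-diagonal i)) (*-identityʳ _)))

  Exact : ∀ M → (Fin (5 ℕ.+ M) → Carrier) → Set (c ⊔ ℓ)
  Exact M s = Combination (column (suc M)) s (4 ℕ.+ M)

  module Star M (s : Fin (5 ℕ.+ M) → Carrier) where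

    nonzero? : ∀ (j : Fin (4 ℕ.+ M)) → Dec (s (suc j) ≉0)
    nonzero? j = ¬? (s (suc j) ≟ 0#)

    assemble : ∀ ns zs → allFin (4 ℕ.+ M) ↭ ns ++ zs → Unique ns →
               All (λ j → s (suc j) ≉0) ns → All (λ j → s (suc j) ≈ 0#) zs →
               (x : Fin (4 ℕ.+ M) → Digit) (a : Carrier) → Fan zs a → s zero ≈ sum (λ j → s (suc j) * scalar (x j)) + a → Exact M s
    assemble ns zs all↭ ns-unique ns≉0 zs≈0 x a fan s₀≈ = combination (map term ns ++ map (map₁ inj₂) terms) count
      (AllPairsₚ.++⁺ (AllPairsₚ.map⁺ {f = term} (AllPairs.map (λ {i} {j} i≢j → i≢j ∘ affine-injective M {i} {j} {x i} {x j}) ns-unique))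
        (AllPairsₚ.map⁺ (AllPairs.map (λ ne → ne ∘ Sumₚ.inj₂-injective) distinct))
        (Allₚ.map⁺ {f = term} (All.map (λ {j} sⱼ≉0 → Allₚ.map⁺ (All.map (λ {t} on → affine∉fan M {j} {x j} on
          (All.map (λ sᵢ≈0 → λ { ≡.refl → sⱼ≉0 sᵢ≈0 }) zs≈0)) onLines)) ns≉0)))
      (Allₚ.++⁺ (Allₚ.map⁺ {f = term} ns≉0) (Allₚ.map⁺ nonzero)) value′
      where
      open Fan fan
      term : Fin (4 ℕ.+ M) → Index (suc M) × Carrier
      term j = affine M j (x j) , s (suc j)
      count : length (map term ns ++ map (map₁ inj₂) terms) ≡ 4 ℕ.+ M
      count = ≡.trans (Listₚ.length-++ (map term ns)) (≡.trans
        (≡.cong₂ ℕ._+_ (Listₚ.length-map term ns) (≡.trans (Listₚ.length-map (map₁ inj₂) terms) length≡)) (≡.trans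
        (≡.sym (Listₚ.length-++ ns)) (≡.trans (≡.sym (↭ₚ.↭-length all↭)) (Listₚ.length-tabulate id))))
      -- The terms over `zs` have coefficient 0 and may be added, after which the list is a
      -- permutation of all indices and the sum runs over every j.
      lines : ∀ row → eval (column (suc M)) (map term ns) row ≈ sum (λ j → s (suc j) * column (suc M) (affine M j (x j)) row)
      lines row = begin
        eval (column (suc M)) (map term ns) row
          ≈⟨ +-identityʳ _ ⟨
        eval (column (suc M)) (map term ns) row + 0#
          ≈⟨ +-congˡ (eval-zeros (column (suc M)) (map term zs) row (Allₚ.map⁺ {f = term} zs≈0)) ⟨
        eval (column (suc M)) (map term ns) row + eval (column (suc M)) (map term zs) row
          ≈⟨ eval-++ (column (suc M)) (map term ns) (map term zs) row ⟨
        eval (column (suc M)) (map term ns ++ map term zs) row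
          ≡⟨ ≡.cong (λ L → eval (column (suc M)) L row) (Listₚ.map-++ term ns zs) ⟨
        eval (column (suc M)) (map term (ns ++ zs)) row
          ≈⟨ eval-↭ (column (suc M)) (↭ₚ.map⁺ term all↭) row ⟨
        eval (column (suc M)) (map term (allFin _)) row
          ≡⟨ ≡.cong (λ L → eval (column (suc M)) L row) (Listₚ.map-tabulate id term) ⟩
        eval (column (suc M)) (tabulate term) row
          ≈⟨ eval-tabulate (column (suc M)) term row ⟩
        sum (λ j → s (suc j) * column (suc M) (affine M j (x j)) row) ∎
      total : ∀ row → eval (column (suc M)) (map term ns ++ map (map₁ inj₂) terms) row ≈
              sum (λ j → s (suc j) * column (suc M) (affine M j (x j)) row) + baseMultiple a row
      total row = trans (eval-++ (column (suc M)) (map term ns) _ row) (+-cong (lines row)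
        (trans (eval-map inj₂ (column (suc M)) terms row) (sym (value row))))
      value′ : ∀ row → s row ≈ eval (column (suc M)) (map term ns ++ map (map₁ inj₂) terms) row
      value′ zero      = trans s₀≈ (trans (+-congʳ (sum-cong-≋ (λ j → *-congˡ {s (suc j)} (sym (affine-zero M j (x j)))))) (sym (total zero)))
      value′ (suc row) = trans (sum-δ (s ∘ suc) row) (trans
        (sum-cong-≋ (λ j → *-congˡ {s (suc j)} (sym (affine-suc M j (x j) row)))) (trans (sym (+-identityʳ _)) (sym (total (suc row)))))

    other : Digit → Digit
    other zero    = 1F
    other (suc _) = 0F

    other-differs : ∀ x → scalar x - scalar (other x) ≉0
    other-differs x = ≉⇒-≉0 (λ eq → differs x (scalar-injective {x} {other x} eq))
      where
      differs : ∀ x → x ≢ other x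
      differs zero    ()
      differs (suc _) ()

    change-at : ∀ {n} → Fin n → (Fin n → Digit) → Fin n → Digit
    change-at i x j with j Fin.≟ i
    ... | yes _ = other (x j)
    ... | no  _ = x j

    change-at-here : ∀ {n} i (x : Fin n → Digit) → change-at i x i ≡ other (x i)
    change-at-here i x with i Fin.≟ i
    ... | yes _  = ≡.refl
    ... | no i≢i = ⊥-elim (i≢i ≡.refl)

    change-at-elsewhere : ∀ {n} i (x : Fin n → Digit) j → j ≢ i → change-at i x j ≡ x j
    change-at-elsewhere i x j j≢i with j Fin.≟ i
    ... | yes j≡i = ⊥-elim (j≢i j≡i)
    ... | no  _   = ≡.refl

    sum-change-at : ∀ i (x : Fin (4 ℕ.+ M) → Digit) → sum (λ j → s (suc j) * scalar (x j)) ≈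
                    sum (λ j → s (suc j) * scalar (change-at i x j)) + s (suc i) * (scalar (x i) - scalar (other (x i)))
    sum-change-at i x = begin
      sum (λ j → s (suc j) * scalar (x j))
        ≈⟨ sum-cong-≋ (λ j → solve 3 (λ s x y → s :* x := s :* y :+ s :* (x :- y)) refl (s (suc j)) (scalar (x j)) (scalar (change-at i x j))) ⟩
      sum (λ j → s (suc j) * scalar (change-at i x j) + s (suc j) * (scalar (x j) - scalar (change-at i x j)))
        ≈⟨ ∑-distrib-+ (λ j → s (suc j) * scalar (change-at i x j)) (λ j → s (suc j) * (scalar (x j) - scalar (change-at i x j))) ⟩
      sum (λ j → s (suc j) * scalar (change-at i x j)) + sum (λ j → s (suc j) * (scalar (x j) - scalar (change-at i x j)))
        ≈⟨ +-congˡ (sum-single +-commutativeMonoid (λ j → s (suc j) * (scalar (x j) - scalar (change-at i x j))) i (λ j j≢i →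
             trans (*-congˡ (x≈y⇒x-y≈0 (reflexive (≡.cong scalar (≡.sym (change-at-elsewhere i x j j≢i)))))) (zeroʳ _))) ⟩
      sum (λ j → s (suc j) * scalar (change-at i x j)) + s (suc i) * (scalar (x i) - scalar (change-at i x i))
        ≡⟨ ≡.cong (λ y → sum (λ j → s (suc j) * scalar (change-at i x j)) + s (suc i) * (scalar (x i) - scalar y)) (change-at-here i x) ⟩
      sum (λ j → s (suc j) * scalar (change-at i x j)) + s (suc i) * (scalar (x i) - scalar (other (x i))) ∎

    -- Lines with zero coefficient are made up for by a fan; unless all coefficients vanish, moving
    -- the point on one of the other lines makes the multiple of e₀ left to the fan nonzero.
    distribute : ∀ ns zs → allFin (4 ℕ.+ M) ↭ ns ++ zs → Unique ns → Unique zs →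
                 All (λ j → s (suc j) ≉0) ns → All (λ j → s (suc j) ≈ 0#) zs →
                 (x : Fin (4 ℕ.+ M) → Digit) → s zero ≈ sum (λ j → s (suc j) * scalar (x j)) → Exact M s
    distribute ns [] all↭ un uz ns≉0 zs≈0 x s₀≈ =
      assemble ns [] all↭ un ns≉0 zs≈0 x 0# (fan-[] refl) (trans s₀≈ (sym (+-identityʳ _)))
    distribute [] zs@(_ ∷ _) all↭ un uz ns≉0 zs≈0 x s₀≈ =
      assemble [] zs all↭ un ns≉0 zs≈0 x 0# (fan-≈0 zs uz 3≤) (trans s₀≈ (sym (+-identityʳ _)))
      where
      3≤ : 3 ≤ length zs
      3≤ = ≡.subst (3 ≤_) (≡.trans (≡.sym (Listₚ.length-tabulate {n = 4 ℕ.+ M} id)) (↭ₚ.↭-length all↭)) (s≤s (s≤s (s≤s z≤n)))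
    distribute (n ∷ ns) (z ∷ zs) all↭ un uz ns≉0@(sₙ≉0 ∷ _) zs≈0 x s₀≈ =
      assemble (n ∷ ns) (z ∷ zs) all↭ un ns≉0 zs≈0 (change-at n x) _
        (fan-≉0 z zs uz (*-≉0 sₙ≉0 (other-differs (x n)))) (trans s₀≈ (sum-change-at n x))

    star : (x : Fin (4 ℕ.+ M) → Digit) → s zero ≈ sum (λ j → s (suc j) * scalar (x j)) → Exact M s
    star = distribute (filter nonzero? (allFin _)) (filter (¬? ∘ nonzero?) (allFin _)) (filter-++-∁-↭ nonzero? (allFin _))
      (filter⁺ nonzero? (allFin⁺ _)) (filter⁺ (¬? ∘ nonzero?) (allFin⁺ _)) (Allₚ.all-filter nonzero? (allFin _))
      (All.map (λ {j} ¬¬≈0 → decidable-stable (s (suc j) ≟ 0#) ¬¬≈0) (Allₚ.all-filter (¬? ∘ nonzero?) (allFin _)))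

    -- Older points vanish in coordinate 0, so s₀ e₀ is left to a fan. Any 4 + M - m edges will do,
    -- since fan points are new; there is at least one because m ≤ 3 + M.
    extend : s zero ≉0 → ∀ {m} → m ≤ 3 ℕ.+ M → Combination (column M) (s ∘ suc) m → Exact M s
    extend s₀≉0 {m} m≤3+M (combination terms length≡ distinct nonzero value) = build (take (4 ℕ.+ M ∸ m) (allFin _))
      (take⁺ (4 ℕ.+ M ∸ m) (allFin⁺ _)) length-zs
      where
      length-zs : length (take (4 ℕ.+ M ∸ m) (allFin (4 ℕ.+ M))) ≡ suc (3 ℕ.+ M ∸ m)
      length-zs = ≡.trans (Listₚ.length-take (4 ℕ.+ M ∸ m) _) (≡.trans (≡.cong ((4 ℕ.+ M ∸ m) ℕ.⊓_) (Listₚ.length-tabulate id))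
        (≡.trans (ℕₚ.m≤n⇒m⊓n≡m (ℕₚ.m∸n≤m (4 ℕ.+ M) m)) (ℕₚ.+-∸-assoc 1 m≤3+M)))
      build : ∀ zs → Unique zs → length zs ≡ suc (3 ℕ.+ M ∸ m) → Exact M s
      build (z ∷ zs) uz lz = combination (map (map₁ inj₁) terms ++ map (map₁ inj₂) fan.terms)
          (≡.trans (Listₚ.length-++ (map (map₁ inj₁) terms)) (≡.trans
            (≡.cong₂ ℕ._+_ (≡.trans (Listₚ.length-map (map₁ inj₁) terms) length≡) (≡.trans (Listₚ.length-map (map₁ inj₂) fan.terms) (≡.trans fan.length≡ lz)))
            (≡.trans (ℕₚ.+-suc m _) (≡.cong suc (ℕₚ.m+[n∸m]≡n m≤3+M)))))
          (AllPairsₚ.++⁺ (AllPairsₚ.map⁺ (AllPairs.map (λ ne → ne ∘ Sumₚ.inj₁-injective) distinct))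
            (AllPairsₚ.map⁺ (AllPairs.map (λ ne → ne ∘ Sumₚ.inj₂-injective) fan.distinct))
            (Allₚ.map⁺ (All.tabulate (λ _ → Allₚ.map⁺ (All.tabulate (λ _ ()))))))
          (Allₚ.++⁺ (Allₚ.map⁺ nonzero) (Allₚ.map⁺ fan.nonzero)) value′
        where
        module fan = Fan (fan-≉0 z zs uz s₀≉0)
        total : ∀ row → eval (column (suc M)) (map (map₁ inj₁) terms ++ map (map₁ inj₂) fan.terms) row ≈
                eval (column (suc M) ∘ inj₁) terms row + baseMultiple (s zero) row
        total row = trans (eval-++ (column (suc M)) (map (map₁ inj₁) terms) _ row) (+-cong (eval-map inj₁ (column (suc M)) terms row)
          (trans (eval-map inj₂ (column (suc M)) fan.terms row) (sym (fan.value row))))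
        value′ : ∀ row → s row ≈ eval (column (suc M)) (map (map₁ inj₁) terms ++ map (map₁ inj₂) fan.terms) row
        value′ zero      = trans (trans (sym (+-identityˡ _)) (+-congʳ (sym (eval-lower-zero M terms)))) (sym (total zero))
        value′ (suc row) = trans (value row) (trans (sym (eval-lower-suc M terms row)) (trans (sym (+-identityʳ _)) (sym (total (suc row)))))

  Relation : ∀ {n} → (Fin n → Carrier) → (Fin n → Carrier) → Set ℓ
  Relation s c = (∀ i → Scalar (c i)) × NonZeroVector c × linear c s ≈ 0#

  mutual
    -- The core yields only an upper bound on the number of terms. The recursion asks for no more,
    -- and the vertex added next restores exactness by padding.
    cover : ∀ M (s : Fin (4 ℕ.+ M) → Carrier) c → Relation s c → ∃ λ m → m ≤ 3 ℕ.+ M × Combination (column M) s m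
    cover zero s c (c∈F , c≉0 , c·s≈0) = core-combination c c∈F s (trans
      (solve 4 (λ x y z w → x :+ y :+ (z :+ w) := x :+ (y :+ (z :+ (w :+ :0)))) refl _ _ _ _) c·s≈0) c≉0
    cover (suc M) s c rel = 4 ℕ.+ M , ℕₚ.≤-refl , cover-exactly M s c rel

    -- If c₀ ≠ 0, the relation gives s₀ = Σ x_j s_j with x_j in F, so s = Σ s_j (e_j + x_j e₀). If
    -- c₀ = s₀ = 0, the vertices serve, with x_j = 0. Otherwise the relation passes to the tail of
    -- s.
    cover-exactly : ∀ M s c → Relation s c → Exact M s
    cover-exactly M s c (c∈F , c≉0 , c·s≈0) with c zero ≟ 0# | s zero ≟ 0#
    ... | no c₀≉0 | _ = Star.star M s (λ j → digit (x∈F j)) (trans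
            (sym (solve-for-head (s zero) (s ∘ suc) c c₀≉0 c·s≈0))
            (sum-cong-≋ (λ j → trans (*-comm _ (s (suc j))) (*-congˡ {s (suc j)} (sym (scalar-digit (x∈F j)))))))
      where
      x∈F : ∀ j → Scalar (- (recip (c zero) * c (suc j)))
      x∈F j = -‿∈F (*-∈F (recip-∈F c₀≉0 (c∈F zero)) (c∈F (suc j)))
    ... | yes c₀≈0 | yes s₀≈0 = Star.star M s (λ _ → zero)
            (trans s₀≈0 (sym (sum-zero +-commutativeMonoid (λ j → s (suc j) * 0#) (λ j → zeroʳ (s (suc j))))))
    ... | yes c₀≈0 | no s₀≉0 =
            let m , m≤ , comb = cover M (s ∘ suc) (c ∘ suc)
                  (c∈F ∘ suc , tail≉0 c≉0 , drop-head (s zero) (s ∘ suc) c c₀≈0 c·s≈0) in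
            Star.extend M s s₀≉0 m≤ comb
      where
      tail≉0 : NonZeroVector c → NonZeroVector (c ∘ suc)
      tail≉0 (zero  , c₀≉0) = ⊥-elim (c₀≉0 c₀≈0)
      tail≉0 (suc i , cᵢ≉0) = i , cᵢ≉0

-- The concatenating construction

module Concatenation {c ℓ : Level} (K : CommutativeRing c ℓ) (isField : IsField K)
                (q : ℕ) (order : HasOrder K q) where

  open CommutativeRing K hiding (zero)
  open IntegerSolver K
  open FieldProperties K isField q order
  open import Relation.Binary.Reasoning.Setoid setoid

  Σ≡sum : ∀ k f → Σ[_] K k f ≡ sum f
  Σ≡sum zero    f = ≡.refl
  Σ≡sum (suc k) f = ≡.cong (f zero +_) (Σ≡sum k (f ∘ suc))

  -- Subtracting β₀ times equation k from equation k + 1 eliminates z₀ and leaves a smaller system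
  -- in (β_i - β₀) z_i; equation 0 then gives z₀.
  vandermonde : ∀ {n} (β : Fin n → Carrier) → (∀ {i j} → β i ≈ β j → i ≡ j) → (u : ℕ → Carrier) →
                ∃ λ (z : Fin n → Carrier) → ∀ k → k < n → sum (λ i → z i * β i ^ k) ≈ u k
  vandermonde {zero}  β β-injective u = (λ ()) , λ _ ()
  vandermonde {suc n} β β-injective u = z , solution
    where
    rest : ∃ λ (z : Fin n → Carrier) → ∀ k → k < n → sum (λ i → z i * β (suc i) ^ k) ≈ u (suc k) - β zero * u k
    rest = vandermonde (β ∘ suc) (λ eq → Finₚ.suc-injective (β-injective eq)) (λ k → u (suc k) - β zero * u k)
    d : Fin n → Carrier
    d i = β (suc i) - β zero
    d≉0 : ∀ i → d i ≉0
    d≉0 i = ≉⇒-≉0 (λ eq → Finₚ.0≢1+n (≡.sym (β-injective eq)))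
    tail : Fin n → Carrier
    tail i = recip (d i) * proj₁ rest i
    z : Fin (suc n) → Carrier
    z zero    = u 0 - sum tail
    z (suc i) = tail i
    solution : ∀ k → k < suc n → sum (λ i → z i * β i ^ k) ≈ u k
    solution zero _ = begin
      (u 0 - sum tail) * 1# + sum (λ i → tail i * 1#)  ≈⟨ +-cong (*-identityʳ _) (sum-cong-≋ (λ i → *-identityʳ (tail i))) ⟩
      u 0 - sum tail + sum tail                        ≈⟨ solve 2 (λ u s → u :- s :+ s := u) refl (u 0) (sum tail) ⟩
      u 0                                              ∎
    solution (suc k) (s≤s k<n) = begin
      z zero * (β zero * β zero ^ k) + sum (λ i → tail i * (β (suc i) * β (suc i) ^ k))
        ≈⟨ +-congˡ (sum-cong-≋ (λ i → solve 4 (λ t b₀ b p → t :* (b :* p) := (b :- b₀) :* t :* p :+ b₀ :* (t :* p))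
             refl (tail i) (β zero) (β (suc i)) (β (suc i) ^ k))) ⟩
      z zero * (β zero * β zero ^ k) + sum (λ i → d i * tail i * β (suc i) ^ k + β zero * (tail i * β (suc i) ^ k))
        ≈⟨ +-congˡ (∑-distrib-+ (λ i → d i * tail i * β (suc i) ^ k) (λ i → β zero * (tail i * β (suc i) ^ k))) ⟩
      z zero * (β zero * β zero ^ k) + (sum (λ i → d i * tail i * β (suc i) ^ k) + sum (λ i → β zero * (tail i * β (suc i) ^ k)))
        ≈⟨ +-congˡ (+-cong (sum-cong-≋ (λ i → *-congʳ (*-recip-cancelˡ (proj₁ rest i) (d≉0 i))))
             (sym (*-distribˡ-sum (β zero) (λ i → tail i * β (suc i) ^ k)))) ⟩
      z zero * (β zero * β zero ^ k) + (sum (λ i → proj₁ rest i * β (suc i) ^ k) + β zero * sum (λ i → tail i * β (suc i) ^ k))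
        ≈⟨ +-congˡ (+-congʳ (proj₂ rest k k<n)) ⟩
      z zero * (β zero * β zero ^ k) + (u (suc k) - β zero * u k + β zero * sum (λ i → tail i * β (suc i) ^ k))
        ≈⟨ solve 6 (λ z b p u′ u s → z :* (b :* p) :+ (u′ :- b :* u :+ b :* s) := u′ :+ b :* ((z :* p :+ s) :- u))
             refl (z zero) (β zero) (β zero ^ k) (u (suc k)) (u k) (sum (λ i → tail i * β (suc i) ^ k)) ⟩
      u (suc k) + β zero * (sum (λ i → z i * β i ^ k) - u k)
        ≈⟨ +-congˡ (trans (*-congˡ (x≈y⇒x-y≈0 (solution k (ℕₚ.<-trans k<n (ℕₚ.n<1+n n))))) (zeroʳ _)) ⟩
      u (suc k) + 0#
        ≈⟨ +-identityʳ _ ⟩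
      u (suc k) ∎

  extendByZero : ∀ {n} → (Fin n → Carrier) → ℕ → Carrier
  extendByZero {n} u k with k ℕ.<? n
  ... | yes k<n = u (fromℕ< k<n)
  ... | no  _   = 0#

  extendByZero-toℕ : ∀ {n} (u : Fin n → Carrier) i → extendByZero u (toℕ i) ≡ u i
  extendByZero-toℕ {n} u i with toℕ i ℕ.<? n
  ... | yes i<n = ≡.cong u (Finₚ.fromℕ<-toℕ i i<n)
  ... | no  i≮n = ⊥-elim (i≮n (Finₚ.toℕ<n i))

  record ExactCombination {r n} (H : Matrix K r n) (m : ℕ) (s : Fin r → Carrier) : Set (c ⊔ ℓ) where
    field
      columns      : Fin m → Fin n
      coefficients : Fin m → Carrier
      injective    : ∀ {i j} → columns i ≡ columns j → i ≡ j
      nonzero      : ∀ i → coefficients i ≉0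
      value        : ∀ row → s row ≈ sum (λ i → coefficients i * H row (columns i))

  -- `e` codes the vector ξ through the positions of its coordinates in the enumeration of K; `k` is
  -- the exponent of the multiplier, starting from 0.
  lowerEntry : ∀ {n R m} → (Fin n → Carrier) → Fin n × Fin (q ℕ.^ m) → Fin R × Fin m → Carrier
  lowerEntry β (j , e) (k , l) = β j ^ toℕ k * element (finToFun e l)

  -- The q^m-concatenating construction with multipliers in the base field: the columns
  -- (h_j, ξ, β_j ξ, …, β_j^(R-1) ξ) with ξ ranging over K^m.
  concatenate : ∀ {r n} → (Fin n → Carrier) → (R m : ℕ) → Matrix K r n → Matrix K (r ℕ.+ R ℕ.* m) (n ℕ.* q ℕ.^ m)
  concatenate {r} {n} β R m H row col =
    [ (λ i → H i (proj₁ (remQuot (q ℕ.^ m) col))) , (λ i → lowerEntry β (remQuot (q ℕ.^ m) col) (remQuot {R} m i)) ]′ (splitAt r row)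

  concatenate-upper : ∀ {r n} β R m (H : Matrix K r n) i col →
                      concatenate β R m H (i ↑ˡ (R ℕ.* m)) col ≡ H i (proj₁ (remQuot (q ℕ.^ m) col))
  concatenate-upper {r} β R m H i col = ≡.cong [ _ , _ ]′ (Finₚ.splitAt-↑ˡ r i (R ℕ.* m))

  concatenate-lower : ∀ {r n} β R m (H : Matrix K r n) k l j e →
                      concatenate β R m H (r ↑ʳ combine {R} k l) (combine j e) ≡ lowerEntry β (j , e) (k , l)
  concatenate-lower {r} β R m H k l j e = ≡.trans
    (≡.cong [ _ , _ ]′ (Finₚ.splitAt-↑ʳ r (R ℕ.* m) (combine k l)))
    (≡.cong₂ (lowerEntry β) (Finₚ.remQuot-combine j e) (Finₚ.remQuot-combine k l))

  by-blocks : ∀ r R m {p} (P : Fin (r ℕ.+ R ℕ.* m) → Set p) → (∀ i → P (i ↑ˡ (R ℕ.* m))) →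
              (∀ k l → P (r ↑ʳ combine {R} k l)) → ∀ row → P row
  by-blocks r R m P upper lower row = ≡.subst P (Finₚ.join-splitAt r (R ℕ.* m) row) (at (splitAt r row))
    where
    at : ∀ t → P (Fin.join r (R ℕ.* m) t)
    at (inj₁ i) = upper i
    at (inj₂ i) = ≡.subst (P ∘ (r ↑ʳ_)) (Finₚ.combine-remQuot {R} m i) (uncurry lower (remQuot {R} m i))

  concatenate-covers : ∀ {r n} β → (∀ {i j} → β i ≈ β j → i ≡ j) → ∀ R m (H : Matrix K r n) →
                       (∀ s → ExactCombination H R s) → Covers K (concatenate β R m H) R
  concatenate-covers {r} {n} β β-injective R m H exact s =
    R , ℕₚ.≤-refl , col , coefficients , λ row → trans (by-blocks r R m Good upper lower row) (reflexive (≡.sym (Σ≡sum R _)))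
    where
    open ExactCombination (exact (λ i → s (i ↑ˡ (R ℕ.* m))))
    syndrome : Fin m → Fin R → Carrier
    syndrome l k = s (r ↑ʳ combine k l)
    solved : ∀ l → ∃ λ (z : Fin R → Carrier) → ∀ k → k < R → sum (λ i → z i * β (columns i) ^ k) ≈ extendByZero (syndrome l) k
    solved l = vandermonde (β ∘ columns) (injective ∘ β-injective) (extendByZero (syndrome l))
    ξ : Fin R → Fin m → Carrier
    -- The unknown of the system is the coefficient times ξ, so ξ is recovered by dividing by a
    -- nonzero coefficient.
    ξ i l = recip (coefficients i) * proj₁ (solved l) i
    col : Fin R → Fin (n ℕ.* q ℕ.^ m)
    col i = combine (columns i) (funToFin (index ∘ ξ i))
    Good : Fin (r ℕ.+ R ℕ.* m) → Set ℓ
    Good row = s row ≈ sum (λ i → coefficients i * concatenate β R m H row (col i))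
    upper : ∀ i → Good (i ↑ˡ (R ℕ.* m))
    upper i = trans (value i) (sum-cong-≋ (λ t → *-congˡ (reflexive (≡.trans
      (≡.cong (H i ∘ proj₁) (≡.sym (Finₚ.remQuot-combine (columns t) (funToFin (index ∘ ξ t)))))
      (≡.sym (concatenate-upper β R m H i (col t)))))))
    lower : ∀ k l → Good (r ↑ʳ combine {R} k l)
    lower k l = begin
      syndrome l k
        ≡⟨ extendByZero-toℕ (syndrome l) k ⟨
      extendByZero (syndrome l) (toℕ k)
        ≈⟨ proj₂ (solved l) (toℕ k) (Finₚ.toℕ<n k) ⟨
      sum (λ i → proj₁ (solved l) i * β (columns i) ^ toℕ k)
        ≈⟨ sum-cong-≋ entry ⟩
      sum (λ i → coefficients i * concatenate β R m H (r ↑ʳ combine k l) (col i)) ∎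
      where
      entry : ∀ i → proj₁ (solved l) i * β (columns i) ^ toℕ k ≈ coefficients i * concatenate β R m H (r ↑ʳ combine k l) (col i)
      entry i = begin
        proj₁ (solved l) i * β (columns i) ^ toℕ k
          ≈⟨ *-congʳ (*-recip-cancelˡ (proj₁ (solved l) i) (nonzero i)) ⟨
        coefficients i * ξ i l * β (columns i) ^ toℕ k
          ≈⟨ solve 3 (λ a x b → a :* x :* b := a :* (b :* x)) refl (coefficients i) (ξ i l) (β (columns i) ^ toℕ k) ⟩
        coefficients i * (β (columns i) ^ toℕ k * ξ i l)
          ≈⟨ *-congˡ (*-congˡ (element-index (ξ i l))) ⟨
        coefficients i * (β (columns i) ^ toℕ k * element (index (ξ i l)))
          ≡⟨ ≡.cong (λ x → coefficients i * (β (columns i) ^ toℕ k * element x)) (Finₚ.finToFun-funToFin (index ∘ ξ i) l) ⟨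
        coefficients i * (β (columns i) ^ toℕ k * element (finToFun (funToFin (index ∘ ξ i)) l))
          ≡⟨ ≡.cong (coefficients i *_) (concatenate-lower β R m H k l (columns i) (funToFin (index ∘ ξ i))) ⟨
        coefficients i * concatenate β R m H (r ↑ʳ combine k l) (col i) ∎

-- Counting the columns

open import Data.Nat using (_+_; _*_; _^_)

size : ℕ → ℕ → ℕ
size r zero    = 4 * (4 + r)
size r (suc M) = size r M + suc ((4 + M) * (2 + r))

-- Equals R(R + 1)/2 - 2 for R = 4 + M, the number of edges and core lines; at R = 4 these are 10 -
-- 6 edges and 4 lines.
edges : ℕ → ℕ
edges zero    = 8
edges (suc M) = edges M + (5 + M)

-- Stated as a multiple of 2 so that the division in `n1` is seen to be exact.
triangular : ∀ M → (4 + M) * (4 + M + 1) ≡ (edges M + 2) * 2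
triangular zero    = ≡.refl
triangular (suc M) = ≡.trans
  (solve 1 (λ m → (con 5 :+ m) :* (con 5 :+ m :+ con 1) := (con 4 :+ m) :* (con 4 :+ m :+ con 1) :+ (con 5 :+ m) :* con 2) ≡.refl M)
  (≡.trans (≡.cong (_+ (5 + M) * 2) (triangular M))
    (solve 2 (λ m e → (e :+ con 2) :* con 2 :+ (con 5 :+ m) :* con 2 := (e :+ (con 5 :+ m) :+ con 2) :* con 2) ≡.refl M (edges M)))
  where open +-*-Solver

n1-edges : ∀ M r → n1 (4 + M) (3 + r) ≡ (2 + r) * edges M + (4 + M) + 5
n1-edges M r = ≡.cong (λ e → (2 + r) * e + (4 + M) + 5) (≡.trans
  (≡.cong (λ e → e ℕ./ 2 ∸ 2) (triangular M))
  (≡.trans (≡.cong (_∸ 2) (m*n/n≡m (edges M + 2) 2)) (ℕₚ.m+n∸n≡m (edges M) 2)))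

size-edges : ∀ M r → size r (suc M) ≡ (2 + r) * edges M + (4 + M) + 5
size-edges zero    r = solve 1 (λ r → con 4 :* (con 4 :+ r) :+ (con 1 :+ con 4 :* (con 2 :+ r)) := (con 2 :+ r) :* con 8 :+ con 4 :+ con 5) ≡.refl r
  where open +-*-Solver
size-edges (suc M) r = ≡.trans (≡.cong (_+ suc ((5 + M) * (2 + r))) (size-edges M r))
  (solve 3 (λ m r e → (con 2 :+ r) :* e :+ (con 4 :+ m) :+ con 5 :+ (con 1 :+ (con 5 :+ m) :* (con 2 :+ r))
     := (con 2 :+ r) :* (e :+ (con 5 :+ m)) :+ (con 5 :+ m) :+ con 5) ≡.refl M r (edges M))
  where open +-*-Solver

size≡n1 : ∀ M r → size r (suc M) ≡ n1 (4 + M) (3 + r)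
size≡n1 M r = ≡.trans (size-edges M r) (≡.sym (n1-edges M r))

5+M≤edges : ∀ M → 5 + M ≤ edges M
5+M≤edges zero    = ℕₚ.m≤m+n 5 3
5+M≤edges (suc M) = ℕₚ.+-mono-≤ {1} (ℕₚ.≤-trans (s≤s z≤n) (5+M≤edges M)) ℕₚ.≤-refl

-- For R = 4 the length is 8q' + 1 ≤ 9q' ≤ q'^4. Raising R by one adds at most twice the length,
-- while the right side grows by the factor q' ≥ 3.
edges-bound : ∀ M r → (2 + r) * edges M + (4 + M) + 5 ≤ (3 + r) ^ (4 + M)
edges-bound zero r = begin
  (2 + r) * 8 + 4 + 5          ≡⟨ solve 1 (λ r → (con 2 :+ r) :* con 8 :+ con 4 :+ con 5 := con 1 :+ (con 3 :+ r) :* con 8) ≡.refl r ⟩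
  1 + (3 + r) * 8              ≤⟨ ℕₚ.+-monoˡ-≤ ((3 + r) * 8) {1} {3 + r} (s≤s z≤n) ⟩
  (3 + r) + (3 + r) * 8        ≡⟨ ℕₚ.*-suc (3 + r) 8 ⟨
  (3 + r) * 9                  ≤⟨ ℕₚ.*-monoʳ-≤ (3 + r) (ℕₚ.≤-trans (ℕₚ.m≤m+n 9 18) (ℕₚ.^-monoˡ-≤ 3 (ℕₚ.m≤m+n 3 r))) ⟩
  (3 + r) * (3 + r) ^ 3        ∎
  where open ℕₚ.≤-Reasoning; open +-*-Solver
edges-bound (suc M) r = begin
  (2 + r) * (edges M + (5 + M)) + (5 + M) + 5   ≡⟨ solve 3 (λ m r e → (con 2 :+ r) :* (e :+ (con 5 :+ m)) :+ (con 5 :+ m) :+ con 5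
                                                   := ((con 2 :+ r) :* e :+ (con 4 :+ m) :+ con 5) :+ ((con 2 :+ r) :* (con 5 :+ m) :+ con 1)) ≡.refl M r (edges M) ⟩
  n + ((2 + r) * (5 + M) + 1)                   ≤⟨ ℕₚ.+-monoʳ-≤ n (ℕₚ.+-mono-≤ (ℕₚ.≤-trans (ℕₚ.*-monoʳ-≤ (2 + r) (5+M≤edges M))
                                                     (ℕₚ.≤-trans (ℕₚ.m≤m+n _ (4 + M)) (ℕₚ.m≤m+n _ 5))) (ℕₚ.≤-trans (s≤s z≤n) (ℕₚ.m≤n+m 5 _))) ⟩
  n + (n + n)                                   ≡⟨ solve 1 (λ n → n :+ (n :+ n) := con 3 :* n) ≡.refl n ⟩
  3 * n                                         ≤⟨ ℕₚ.*-mono-≤ (ℕₚ.m≤m+n 3 r) (edges-bound M r) ⟩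
  (3 + r) * (3 + r) ^ (4 + M)                   ∎
  where
  open ℕₚ.≤-Reasoning
  open +-*-Solver
  n : ℕ
  n = (2 + r) * edges M + (4 + M) + 5

size≤q : ∀ M r → size r (suc M) ≤ (3 + r) ^ (4 + M)
size≤q M r = ≡.subst (_≤ (3 + r) ^ (4 + M)) (≡.sym (size-edges M r)) (edges-bound M r)

-- Assembly of the code and its covering radius

module Construction {c ℓ : Level} (K : CommutativeRing c ℓ) (isField : IsField K)
                (q : ℕ) (order : HasOrder K q)
                (p k M r : ℕ) (pr : Prime p) (pᵏ≡3+r : p ^ k ≡ 3 + r)
                (q≡[3+r]^R : q ≡ (3 + r) ^ (4 + M)) where

  private module K = CommutativeRing K
  open K using (Carrier; _≈_; 0#)
  open FieldProperties K isField q order hiding (_^_)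
  open Subfield K isField q order p k (3 + M) (suc r) pr pᵏ≡3+r q≡[3+r]^R
  open LinearAlgebra K isField q order p k (3 + M) (suc r) pr pᵏ≡3+r q≡[3+r]^R
  open CoreLines K isField q order p k (3 + M) (suc r) pr pᵏ≡3+r q≡[3+r]^R
  open BaseCode K isField q order p k (3 + M) r pr pᵏ≡3+r q≡[3+r]^R
  open Concatenation K isField q order

  encodeSpoke : ∀ {n} → Spoke n → Fin (suc (n * (2 + r)))
  encodeSpoke nothing        = zero
  encodeSpoke (just (j , u)) = suc (combine j u)

  decodeSpoke : ∀ {n} → Fin (suc (n * (2 + r))) → Spoke n
  decodeSpoke     zero    = nothing
  decodeSpoke {n} (suc i) = just (remQuot {n} (2 + r) i)

  decode-encodeSpoke : ∀ {n} (t : Spoke n) → decodeSpoke (encodeSpoke t) ≡ t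
  decode-encodeSpoke nothing        = ≡.refl
  decode-encodeSpoke (just (j , u)) = ≡.cong just (Finₚ.remQuot-combine j u)

  encode : ∀ N → Index N → Fin (size r N)
  encode zero    (i , P) = combine i P
  encode (suc N) i       = Fin.join (size r N) _ (map-⊎ (encode N) encodeSpoke i)

  decode : ∀ N → Fin (size r N) → Index N
  decode zero    i = remQuot {4} (4 + r) i
  decode (suc N) i = map-⊎ (decode N) decodeSpoke (splitAt (size r N) i)

  -- Makes `encode` injective and identifies the column of `baseMatrix` at an encoded point.
  decode-encode : ∀ N i → decode N (encode N i) ≡ i
  decode-encode zero    (i , P)  = Finₚ.remQuot-combine i P
  decode-encode (suc N) (inj₁ i) = ≡.trans (≡.cong (map-⊎ (decode N) decodeSpoke) (Finₚ.splitAt-↑ˡ (size r N) (encode N i) _))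
    (≡.cong inj₁ (decode-encode N i))
  decode-encode (suc N) (inj₂ t) = ≡.trans (≡.cong (map-⊎ (decode N) decodeSpoke) (Finₚ.splitAt-↑ʳ (size r N) _ (encodeSpoke t)))
    (≡.cong inj₂ (decode-encodeSpoke t))

  baseMatrix : Matrix K (5 + M) (size r (suc M))
  baseMatrix row i = column (suc M) (decode (suc M) i) row

  eval-lookup : ∀ {I : Set} {n} (col : I → Fin n → Carrier) L row →
                eval col L row ≈ sum (λ i → proj₂ (lookup L i) K.* col (proj₁ (lookup L i)) row)
  eval-lookup col []      row = K.refl
  eval-lookup col (_ ∷ L) row = K.+-congˡ (eval-lookup col L row)

  exactCombination : ∀ {m s} → Combination (column (suc M)) s m → ExactCombination baseMatrix m s
  exactCombination (combination L ≡.refl distinct nonzero value) = record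
    { columns      = λ i → encode (suc M) (proj₁ (lookup L i))
    ; coefficients = λ i → proj₂ (lookup L i)
    ; injective    = λ {i} {j} eq → lookup-injective proj₁ distinct i j (≡.trans (≡.sym (decode-encode (suc M) _))
                       (≡.trans (≡.cong (decode (suc M)) eq) (decode-encode (suc M) _)))
    ; nonzero      = λ i → All.lookup nonzero (∈-lookup i)
    ; value        = λ row → K.trans (value row) (K.trans (eval-lookup (column (suc M)) L row) (sum-cong-≋ (λ i →
                       K.*-congˡ {proj₂ (lookup L i)} (K.reflexive (≡.cong (λ t → column (suc M) t row)
                         (≡.sym (decode-encode (suc M) (proj₁ (lookup L i)))))))))
    }

  exact : ∀ s → ExactCombination baseMatrix (4 + M) s
  exact s = let c , rel = dependent s q<[3+r]^[5+M] in exactCombination (cover-exactly M s c rel)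
    where
    q<[3+r]^[5+M] : q < (3 + r) ^ (5 + M)
    q<[3+r]^[5+M] = ≡.subst (_< (3 + r) ^ (5 + M)) (≡.sym q≡[3+r]^R) (ℕₚ.^-monoʳ-< (3 + r) (s≤s (s≤s z≤n)) (ℕₚ.n<1+n (4 + M)))

  n≤q : size r (suc M) ≤ q
  n≤q = ≡.subst (size r (suc M) ≤_) (≡.sym q≡[3+r]^R) (size≤q M r)

  multiplier : Fin (size r (suc M)) → Carrier
  multiplier i = element (Fin.inject≤ i n≤q)

  multiplier-injective : ∀ {i j} → multiplier i ≈ multiplier j → i ≡ j
  multiplier-injective eq = Finₚ.inject≤-injective n≤q n≤q _ _ (element-injective eq)

  code : ∀ m → Matrix K (5 + M + (4 + M) * m) (size r (suc M) * q ^ m)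
  code m = concatenate multiplier (4 + M) m baseMatrix

  code-covers : ∀ m → Covers K (code m) (4 + M)
  code-covers m = concatenate-covers multiplier multiplier-injective (4 + M) m baseMatrix exact

  code-radius : ∀ m R′ → Covers K (code m) R′ → 4 + M ≤ R′
  code-radius m R′ covers =
    let v , v-independent = independent (4 + M) ℕₚ.≤-refl
        -- The upper block has R + 1 rows, but K has dimension R over F: coordinate 0 is set to 0,
        -- and the rank argument uses the other R rows.
        s = λ row → [ cons 0# v , (λ _ → 0#) ]′ (splitAt (5 + M) row)
        k′ , k′≤R′ , j , a , s≈ = covers s
        upper = λ (i : Fin (4 + M)) → suc i ↑ˡ ((4 + M) * m)
    in ℕₚ.≤-trans (independent-rank v v-independent
         (λ i t → code m (upper i) (j t))
         (λ i t → Scalar-resp (K.reflexive (≡.sym (concatenate-upper multiplier (4 + M) m baseMatrix (suc i) (j t))))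
                    (column-∈F (suc M) (decode (suc M) (proj₁ (remQuot (q ^ m) (j t)))) (suc i)))
         a
         (λ i → K.trans (K.reflexive (≡.sym (≡.cong [ cons 0# v , (λ _ → 0#) ]′ (Finₚ.splitAt-↑ˡ (5 + M) (suc i) ((4 + M) * m)))))
                  (K.trans (s≈ (upper i)) (K.reflexive (Σ≡sum k′ _)))))
       k′≤R′

  code-has-radius : ∀ m → HasCoveringRadius K (code m) (4 + M)
  code-has-radius m = code-covers m , code-radius m

rows : ∀ M m → 5 + M + (4 + M) * m ≡ (4 + M) * suc m + 1
rows = solve 2 (λ M m → con 5 :+ M :+ (con 4 :+ M) :* m := (con 4 :+ M) :* (con 1 :+ m) :+ con 1) ≡.refl
  where open +-*-Solver

CodeOfRadius : ∀ {c ℓ} → CommutativeRing c ℓ → ℕ → ℕ → ℕ → Set _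
CodeOfRadius K R r n = Σ (Matrix K r n) λ H → HasCoveringRadius K H R

code-exists : {c ℓ : Level} (M r p k q : ℕ) → Prime p → 3 + r ≡ p ^ k → q ≡ (3 + r) ^ (4 + M) →
              (K : CommutativeRing c ℓ) → IsField K → HasOrder K q → ∀ m →
              CodeOfRadius K (4 + M) ((4 + M) * suc m + 1) (n1 (4 + M) (3 + r) * q ^ m)
code-exists M r p k q pr q′≡pᵏ q≡ K isField order m =
  ≡.subst₂ (CodeOfRadius K (4 + M)) (rows M m) (≡.cong (_* q ^ m) (size≡n1 M r)) (code m , code-has-radius m)
  where open Construction K isField q order p k M r pr (≡.sym q′≡pᵏ) q≡

n1>1 : ∀ R q′ → 1 < n1 R q′
n1>1 R q′ = ℕₚ.≤-trans (s≤s (s≤s z≤n)) (ℕₚ.m≤n+m 5 ((q′ ∸ 1) * (R * (R + 1) ℕ./ 2 ∸ 2) + R))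

theorem22 : {c ℓ : Level} (R q' q t₀ : ℕ) → 4 ≤ R → 3 ≤ q' → IsPrimePower q' → q ≡ q' ^ R →
    n1 R q' ≤ q ^ (t₀ ∸ 1) →
    (K : CommutativeRing c ℓ) → IsField K → HasOrder K q →
    (t : ℕ) → (t ≡ 1 ⊎ t₀ ≤ t) →
    Σ ℕ λ n → Σ (Matrix K (R * t + 1) n) λ H → HasCoveringRadius K H R ×
    ((4 ≤ q' → n ≡ n1 R q' * q ^ (t ∸ 1)) ×
    (q' ≡ 3 → Σ ℕ λ w → w ≤ 1 × n ≡ n1 R q' * q ^ (t ∸ 1) + w * ((q ^ (t ∸ 1) ∸ 1) /' (q ∸ 1))))
-- For t = 0 the bound t₀ ≤ t gives t₀ ∸ 1 = 0, and the hypothesis on `n1` would read n1 ≤ 1.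
theorem22 R q' q t₀ 4≤R 3≤q' _ _ n1≤ K _ _ zero (inj₂ z≤n) = ⊥-elim (ℕₚ.<⇒≱ (n1>1 R q') n1≤)
theorem22 _ _ q _ (s≤s (s≤s (s≤s (s≤s (z≤n {M}))))) (s≤s (s≤s (s≤s (z≤n {r})))) (p , k , pr , _ , q'≡pᵏ) q≡ _ K isField order (suc m) _ =
  let H , radius = code-exists M r p k q pr q'≡pᵏ q≡ K isField order m in
  _ , H , radius , (λ _ → ≡.refl) , λ _ → 0 , z≤n , ≡.sym (ℕₚ.+-identityʳ _)
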